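{- Let $B_n=[a_n,b_n)\times[c_n,d_n)$, $1\le n\le N$, be pairwise disjoint boxes in $[0,\infty)\times[0,\infty)$ with $a_n<b_n$ and $c_n<d_n$. Let $\{(x_1,y_1),\dots,(x_P,y_P)\}$ be the observed data, where $x_j$ and $y_j$ are the times taken by two equivalent algorithms $\alpha_1$ and $\alpha_2$, respectively, to process the task $\omega_j$ of a finite sample set $\Omega_s$ of tasks, $1\le j\le P=|\Omega_s|$. Let $$S_j=\big|\{(x,y)\in\{(x_1,y_1),\dots,(x_P,y_P)\}:\ a_j\le x<b_j,\ c_j\le y<d_j\}\big|,\qquad 1\le j\le N.$$ Consider the joint densities $$f(x,y)=\sum_{n=1}^N k_n\mathbf 1_{[a_n,b_n)}(x)\,\mathbf 1_{[c_n,d_n)}(y),\qquad k_n>0\ (1\le n\le N),\qquad \sum_{n=1}^N k_n(b_n-a_n)(d_n-c_n)=1,$$ and the performance (likelihood) function $$g(k_1,\dots,k_N)=\prod_{m=1}^P f(x_m,y_m)=\prod_{m=1}^P\sum_{n=1}^N k_n\mathbf 1_{[a_n,b_n)}(x_m)\,\mathbf 1_{[c_n,d_n)}(y_m)=k_1^{S_1}k_2^{S_2}\cdots k_N^{S_N}.$$ Then the maximum-likelihood (best fitting) density of this form, obtained by maximizing $g$ subject to the constraints by Lagrange multipliers, has $$k_j=\frac{S_j}{P\,(b_j-a_j)(d_j-c_j)},\qquad 1\le j\le N,$$ and with these values the mean execution time of the derived algorithm (defined in the context) is $$\begin{aligned}E\,T(\tau_1)={}&-\frac{\tau_1^2}{2P}\sum_{n:\,a_n<\tau_1<b_n}\frac{S_n}{b_n-a_n}+\frac{\tau_1}{P}\Big(\sum_{n:\,\tau_1\le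 a_n}S_n+\sum_{n:\,a_n<\tau_1<b_n}S_n\frac{b_n-\frac12(d_n+c_n)}{b_n-a_n}\Big)\\&+\frac1{2P}\sum_{n:\,a_n<\tau_1<b_n}\frac{S_n}{b_n-a_n}\big(b_n(d_n+c_n)-a_n^2\big)+\frac1{2P}\sum_{n:\,\tau_1\le a_n}S_n(d_n+c_n)+\frac1{2P}\sum_{n:\,b_n\le\tau_1}S_n(b_n+a_n),\end{aligned}$$ where each sum is over the indices $n\in\{1,\dots,N\}$ satisfying the indicated condition.
   Context: Two algorithms are equivalent if they have the same set of tasks and produce the same output on every task; they may take different times. For two equivalent algorithms $\alpha_1,\alpha_2$ with execution times $\pi_{\alpha_1},\pi_{\alpha_2}$, viewed as random variables on a probability space of tasks, and a time limit $\tau_1\ge0$, the derived algorithm runs $\alpha_1$ for time at most $\tau_1$ and, if it has not finished, abandons it and runs $\alpha_2$ to completion. Its execution time is the random variable $$T(\tau_1)=\begin{cases}\pi_{\alpha_1}&\text{if }\pi_{\alpha_1}\le\tau_1,\\ \tau_1+\pi_{\alpha_2}&\text{if }\tau_1<\pi_{\alpha_1}.\end{cases}$$ When the joint density of $(\pi_{\alpha_1},\pi_{\alpha_2})$ is $f$, its mean is $$E\,T(\tau_1)=\int_0^{\tau_1}\!\!\int_0^\infty x f(x,y)\,dy\,dx+\int_{\tau_1}^\infty\!\!\int_0^\infty(\tau_1+y)f(x,y)\,dy\,dx.$$ $\mathbf 1_A$ denotes the indicator function of $A$, and $|A|$ the cardinality of a finite set $A$. Empty sums are $0$.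
   Formalization: Every data point is assumed to lie in some box; S_j counts data points with multiplicity; where some S_j = 0 the maximum is taken over k_n ≥ 0, since no maximizer with all k_n > 0 exists. -}

module Defs where

open import Level using (0ℓ)
open import Algebra.Bundles using (CommutativeRing)
open import Algebra.Structures using (IsCommutativeRing)
open import Data.Bool.Base using (if_then_else_)
open import Data.Fin.Base using (Fin)
open import Data.Nat.Base using (ℕ; suc)
open import Data.Product.Base using (Σ; ∃; ∃-syntax; _×_; _,_; proj₁; proj₂)
open import Data.Vec.Base as Vec using (Vec)
open import Relation.Binary.PropositionalEquality using (_≡_; _≢_)
open import Relation.Binary.Structures using (IsDecTotalOrder)
open import Relation.Nullary.Decidable using (Dec; does; _×-dec_)
open import Relation.Nullary.Negation using (¬_)
open import Relation.Unary using (Decidable)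
import Algebra.Definitions.RawMonoid
import Algebra.Properties.CommutativeMonoid.Sum
import Algebra.Properties.Semiring.Exp
import Algebra.Properties.Semiring.Sum
import Relation.Binary.Construct.NonStrictToStrict as NonStrictToStrict

-- The library has no real numbers.  The classical real line is determined up
-- to isomorphism as the Dedekind-complete totally ordered field, and every
-- statement below is quantified over all models of these axioms.  The order is
-- decidable because indicator functions of intervals are to be functions.

record CompleteOrderedField : Set₁ where
  infix  8 _⁻¹ -_
  infixl 7 _*_
  infixl 6 _+_
  infix  4 _≤_
  field
    ℝ   : Set
    _≤_ : ℝ → ℝ → Set
    _+_ : ℝ → ℝ → ℝ
    _*_ : ℝ → ℝ → ℝ
    -_  : ℝ → ℝ
    0#  : ℝ
    1#  : ℝ
    _⁻¹ : ℝ → ℝ   -- unspecified at 0#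

    isCommutativeRing : IsCommutativeRing _≡_ _+_ _*_ -_ 0# 1#
    0≢1               : 0# ≢ 1#
    *-inverseʳ        : ∀ x → x ≢ 0# → x * x ⁻¹ ≡ 1#
    isDecTotalOrder   : IsDecTotalOrder _≡_ _≤_
    +-monoʳ-≤         : ∀ x {y z} → y ≤ z → x + y ≤ x + z
    *-nonNegative     : ∀ {x y} → 0# ≤ x → 0# ≤ y → 0# ≤ x * y
    supremum          : (A : ℝ → Set) → ∃ A → (∃[ u ] (∀ x → A x → x ≤ u)) →
                        ∃[ s ] ((∀ x → A x → x ≤ s) ×
                                (∀ u → (∀ x → A x → x ≤ u) → s ≤ u))

  commutativeRing : CommutativeRing 0ℓ 0ℓ
  commutativeRing = record { isCommutativeRing = isCommutativeRing }

module Reals (𝓡 : CompleteOrderedField) where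

  open CompleteOrderedField 𝓡 public
  open IsDecTotalOrder isDecTotalOrder public using (_≤?_; _≟_)
  open CommutativeRing commutativeRing public
    using (semiring; *-commutativeMonoid; +-rawMonoid; _-_)
  open NonStrictToStrict _≡_ _≤_ public using (_<_; <-decidable)
  open Algebra.Properties.Semiring.Exp semiring public using (_^_)
  open Algebra.Properties.Semiring.Sum semiring public using () renaming (sum to ∑)
  open Algebra.Properties.CommutativeMonoid.Sum *-commutativeMonoid public
    using () renaming (sum to ∏)
  open Algebra.Definitions.RawMonoid +-rawMonoid using () renaming (_×_ to _·_)

  infixl 7 _/_
  infix  4 _<?_

  _<?_ : ∀ x y → Dec (x < y)
  _<?_ = <-decidable _≟_ _≤?_

  _/_ : ℝ → ℝ → ℝ
  x / y = x * y ⁻¹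

  fromℕ : ℕ → ℝ
  fromℕ n = n · 1#

  ½ : ℝ
  ½ = 1# / fromℕ 2

  ∣_∣ : ℝ → ℝ
  ∣ x ∣ = if does (0# ≤? x) then x else - x

  𝟏 : {A : Set} → Dec A → ℝ
  𝟏 A? = if does A? then 1# else 0#

  ∑-where : ∀ {N} {Q : Fin N → Set} → Decidable Q → (Fin N → ℝ) → ℝ
  ∑-where Q? h = ∑ (λ n → if does (Q? n) then h n else 0#)

  -- A partition of [a , b] with a tag in each (possibly degenerate) cell:
  -- cell t m _ _ π has the leftmost cell [a , m], tagged by t, and π partitions
  -- [m , b].

  data TaggedPartition : ℝ → ℝ → Set where
    empty : ∀ {a} → TaggedPartition a a
    cell  : ∀ {a b} t m → a ≤ t → t ≤ m → TaggedPartition m b → TaggedPartition a b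

  data Finer (δ : ℝ) : ∀ {a b} → TaggedPartition a b → Set where
    empty : ∀ {a} → Finer δ (empty {a})
    cell  : ∀ {a b t m} {a≤t : a ≤ t} {t≤m : t ≤ m} {π : TaggedPartition m b} →
            m - a < δ → Finer δ π → Finer δ (cell t m a≤t t≤m π)

  riemannSum : (ℝ → ℝ) → ∀ {a b} → TaggedPartition a b → ℝ
  riemannSum h empty                = 0#
  riemannSum h (cell {a} t m _ _ π) = h t * (m - a) + riemannSum h π

  -- HasIntegral h a b I  means that h is Riemann integrable on [a , b], with
  -- integral I; it is used only for a ≤ b.

  HasIntegral : (ℝ → ℝ) → ℝ → ℝ → ℝ → Set
  HasIntegral h a b I =
    ∀ ε → 0# < ε → ∃[ δ ] ((0# < δ) ×
      ((π : TaggedPartition a b) → Finer δ π → ∣ riemannSum h π - I ∣ < ε))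

  -- HasIntegral∞ h a I  is the improper version on [a , ∞).

  HasIntegral∞ : (ℝ → ℝ) → ℝ → ℝ → Set
  HasIntegral∞ h a I =
    Σ (ℝ → ℝ) λ J →
      (∀ r → a ≤ r → HasIntegral h a r (J r)) ×
      (∀ ε → 0# < ε → ∃[ M ] (∀ r → a ≤ r → M ≤ r → ∣ J r - I ∣ < ε))

  -- ∫ₐᵇ ∫₀^∞ h(x,y) dy dx = I  and  ∫ₐ^∞ ∫₀^∞ h(x,y) dy dx = I, as iterated
  -- integrals.

  HasIteratedIntegral : (ℝ → ℝ → ℝ) → ℝ → ℝ → ℝ → Set
  HasIteratedIntegral h a b I =
    Σ (ℝ → ℝ) λ inner →
      (∀ x → a ≤ x → x ≤ b → HasIntegral∞ (h x) 0# (inner x)) ×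
      HasIntegral inner a b I

  HasIteratedIntegral∞ : (ℝ → ℝ → ℝ) → ℝ → ℝ → Set
  HasIteratedIntegral∞ h a I =
    Σ (ℝ → ℝ) λ inner →
      (∀ x → a ≤ x → HasIntegral∞ (h x) 0# (inner x)) ×
      HasIntegral∞ inner a I

module Fitting (𝓡 : CompleteOrderedField) where

  open Reals 𝓡 public

  record Algorithm (Task Output : Set) : Set where
    field
      output : Task → Output
      time   : Task → ℝ
      0≤time : ∀ ω → 0# ≤ time ω

  open Algorithm public

  Equivalent : ∀ {Task Output} → Algorithm Task Output → Algorithm Task Output → Set
  Equivalent α₁ α₂ = ∀ ω → output α₁ ω ≡ output α₂ ω

  -- The derived algorithm with time limit τ takes the time
  --   T(τ) = π₁ if π₁ ≤ τ,   T(τ) = τ + π₂ if τ < π₁,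
  -- where (π₁ , π₂) are the times of the two given algorithms.  If f is the
  -- joint density of (π₁ , π₂), then DerivedTimeHasMean f τ μ says E T(τ) = μ:
  --   ∫₀^τ ∫₀^∞ x f(x,y) dy dx + ∫_τ^∞ ∫₀^∞ (τ + y) f(x,y) dy dx = μ.

  DerivedTimeHasMean : (ℝ → ℝ → ℝ) → ℝ → ℝ → Set
  DerivedTimeHasMean f τ μ =
    ∃[ I₁ ] ∃[ I₂ ]
      (HasIteratedIntegral  (λ x y → x * f x y) 0# τ I₁ ×
       HasIteratedIntegral∞ (λ x y → (τ + y) * f x y) τ I₂ ×
       μ ≡ I₁ + I₂)

  record Box : Set where
    field
      a b c d : ℝ
      0≤a : 0# ≤ a
      0≤c : 0# ≤ c
      a<b : a < b
      c<d : c < d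

  InInterval : ℝ → ℝ → ℝ → Set
  InInterval l u x = (l ≤ x) × (x < u)

  inInterval? : ∀ l u x → Dec (InInterval l u x)
  inInterval? l u x = (l ≤? x) ×-dec (x <? u)

  InBox : Box → ℝ × ℝ → Set
  InBox B p = InInterval a b (proj₁ p) × InInterval c d (proj₂ p)
    where open Box B

  inBox? : ∀ B → Decidable (InBox B)
  inBox? B p = inInterval? a b (proj₁ p) ×-dec inInterval? c d (proj₂ p)
    where open Box B

  PairwiseDisjoint : ∀ {N} → (Fin N → Box) → Set
  PairwiseDisjoint B = ∀ i j → i ≢ j → ∀ p → ¬ (InBox (B i) p × InBox (B j) p)

  module Model {N : ℕ} (B : Fin N → Box) where

    private module B n = Box (B n)
    open B public

    density : (Fin N → ℝ) → ℝ → ℝ → ℝ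
    density k x y =
      ∑ (λ n → k n * 𝟏 (inInterval? (a n) (b n) x) * 𝟏 (inInterval? (c n) (d n) y))

    Normalized : (Fin N → ℝ) → Set
    Normalized k = ∑ (λ n → k n * (b n - a n) * (d n - c n)) ≡ 1#

    Admissible : (Fin N → ℝ) → Set
    Admissible k = (∀ n → 0# < k n) × Normalized k

    -- The closure of the admissible set.  The fitted coefficient of a box without
    -- data is 0, so the likelihood may attain its supremum only here.

    Admissible₀ : (Fin N → ℝ) → Set
    Admissible₀ k = (∀ n → 0# ≤ k n) × Normalized k

    module Likelihood {P : ℕ} (data′ : Fin P → ℝ × ℝ) where

      -- Data points are counted with multiplicity, as they are in the
      -- likelihood.

      S : Fin N → ℕ
      S n = Vec.count (inBox? (B n)) (Vec.tabulate data′)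

      likelihood : (Fin N → ℝ) → ℝ
      likelihood k = ∏ (λ m → density k (proj₁ (data′ m)) (proj₂ (data′ m)))

      Maximizes : ((Fin N → ℝ) → Set) → (Fin N → ℝ) → Set
      Maximizes C k = C k × (∀ k′ → C k′ → likelihood k′ ≤ likelihood k)

      fitted : Fin N → ℝ
      fitted n = fromℕ (S n) / (fromℕ P * (b n - a n) * (d n - c n))

      meanFormula : ℝ → ℝ
      meanFormula τ =
          - ((τ ^ 2) / (2# * P#) * ∑-where inside? (λ n → S# n / (b n - a n)))
        + τ / P# *
            ( ∑-where above? S#
            + ∑-where inside?
                (λ n → S# n * ((b n - ½ * (d n + c n)) / (b n - a n))))
        + 1# / (2# * P#) *
            ∑-where inside?
              (λ n → S# n / (b n - a n) * (b n * (d n + c n) - a n ^ 2))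
        + 1# / (2# * P#) * ∑-where above? (λ n → S# n * (d n + c n))
        + 1# / (2# * P#) * ∑-where below? (λ n → S# n * (b n + a n))
        where
        2# = fromℕ 2
        P# = fromℕ P
        S# : Fin N → ℝ
        S# n = fromℕ (S n)
        inside? : Decidable (λ n → (a n < τ) × (τ < b n))
        inside? n = (a n <? τ) ×-dec (τ <? b n)
        above? : Decidable (λ n → τ ≤ a n)
        above? n = τ ≤? a n
        below? : Decidable (λ n → b n ≤ τ)
        below? n = b n ≤? τ

{-# OPTIONS --safe #-}

-- Disjointness gives each data point its own box, so the likelihood of k is a product of
-- coefficients over the data points.  Dividing by the fitted coefficients turns the
-- normalization into an upper bound P for the sum of the P ratios k / fitted at the data
-- points, whence their product is at most 1 by AM-GM.  No other k is a maximizer: as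
-- (½ (x + y))² > x y for x ≠ y, the midpoint of k and the fit would have a larger
-- likelihood than k.
--
-- For the mean, α + β x on [l , u) with α , β , l ≥ 0 is a difference of two monotone
-- functions, which vanish to the left of l and u, and the error of a Riemann sum of a
-- monotone function telescopes.
module Submission where

open import Defs
open import Algebra.Bundles using (CommutativeMonoid; CommutativeRing; RawRing)
import Algebra.Construct.NaturalChoice.Max as MaxConstruct
import Algebra.Construct.NaturalChoice.Min as MinConstruct
import Algebra.Definitions.RawMonoid as RawMonoidDefinitions
import Algebra.Properties.CommutativeMonoid.Sum as MonoidSum
import Algebra.Properties.Semiring.Mult as SemiringMult
import Algebra.Properties.Semiring.Sum as SemiringSum
import Algebra.Solver.Ring as RingSolver
open import Algebra.Solver.Ring.AlmostCommutativeRing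
  using (fromCommutativeRing; _-Raw-AlmostCommutative⟶_)
open import Data.Bool.Base using (true; false; if_then_else_)
open import Data.Fin.Base using (Fin; zero; suc)
import Data.Fin.Properties as Fin
open import Data.Integer.Base as ℤ using (ℤ; -[1+_]; _⊖_; _◃_)
import Data.Integer.Properties as ℤ
open import Data.Maybe.Base using (Maybe; map)
open import Data.Nat.Base as ℕ using (ℕ; zero; suc; NonZero; z≤n; s≤s)
import Data.Nat.Properties as ℕ
open import Data.Product.Base using (_×_; _,_; ∃-syntax; proj₁; proj₂)
import Data.Sign.Base as Sign
open import Data.Sum.Base using (inj₁; inj₂)
import Data.Vec.Base as Vec
open import Function.Base using (_∘_)
open import Function.Definitions using (Injective)
open import Level using (0ℓ)
open import Relation.Binary.Bundles using (TotalOrder)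
import Relation.Binary.Construct.NonStrictToStrict as NonStrict
open import Relation.Binary.PropositionalEquality
  using (_≡_; _≢_; refl; sym; trans; cong; cong₂; subst; subst₂; module ≡-Reasoning)
import Relation.Binary.Reasoning.PartialOrder as PartialOrderReasoning
open import Relation.Binary.Structures using (IsDecTotalOrder)
open import Relation.Nullary.Decidable
  using (Dec; yes; no; does; _×-dec_; dec⇒maybe; dec-true; dec-false; decidable-stable)
open import Relation.Nullary.Negation using (¬_; contradiction)
open import Relation.Unary using (Decidable)

-- The fit need not be a competitor: a box without data gets the coefficient 0, which `Admissible`
-- forbids. The midpoint of a positive `k` and the fit is positive and normalized, so it can be
-- compared with `k` inside `Admissible` as well as inside `Admissible₀`, and one argument gives
-- uniqueness in both sets. For the same reason the ratios `k / fitted` are formed only at data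
-- points, whose boxes have a positive count; the mass that `k` puts on empty boxes is what turns
-- the normalization into a mere upper bound. AM-GM is stated with a power of a bound for the mean,
-- so no roots, logarithms or derivatives occur: a global inequality takes the place of the Lagrange
-- multipliers. On each box the density is constant, so the share of a box in the mean is built from
-- one-dimensional integrals of `1`, `x` and `τ + y`. The groups of sums in the formula are the
-- three positions of `τ` relative to `[a n , b n)`.

-- The elements of an abstract field cannot be compared during type checking, so the
-- ring solver gets integer coefficients, for which cancellation is decided.
module IntegerCoefficients (R : CommutativeRing 0ℓ 0ℓ) where
  open import Data.Integer.Base using (+_)
  open CommutativeRing R renaming (refl to ≈-refl; sym to ≈-sym; trans to ≈-trans)
  open import Algebra.Properties.Semiring.Mult.TCOptimised semiring using (×-homo-+; ×1-homo-*; 1+×)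
    renaming (_×_ to _×′_)
  open import Algebra.Properties.Ring ring
  open import Relation.Binary.Reasoning.Setoid setoid
  open import Algebra.Properties.CommutativeSemigroup +-commutativeSemigroup using (interchange)

  -- The optimised multiple has `1 ×′ 1#` equal to `1#` by computation, so `1-homo` is reflexivity
  -- and the constant 1 of the solver denotes `1#` itself.
  embed : ℤ → Carrier
  embed (+ n)    = n ×′ 1#
  embed -[1+ n ] = - (suc n ×′ 1#)

  -- Integer addition of mixed signs computes through `_⊖_`; the induction cancels one `1#` from
  -- each part.
  embed-⊖ : ∀ m n → embed (m ⊖ n) ≈ m ×′ 1# - n ×′ 1#
  embed-⊖ zero    zero    = ≈-sym (-‿inverseʳ 0#)
  embed-⊖ zero    (suc n) = ≈-sym (+-identityˡ _)
  embed-⊖ (suc m) zero    = ≈-sym (≈-trans (+-congˡ -0#≈0#) (+-identityʳ _))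
  embed-⊖ (suc m) (suc n) = begin
    embed (suc m ⊖ suc n)                    ≡⟨ cong embed (ℤ.[1+m]⊖[1+n]≡m⊖n m n) ⟩
    embed (m ⊖ n)                            ≈⟨ embed-⊖ m n ⟩
    m ×′ 1# - n ×′ 1#                        ≈⟨ +-identityˡ _ ⟨
    0# + (m ×′ 1# - n ×′ 1#)                 ≈⟨ +-congʳ (-‿inverseʳ 1#) ⟨
    (1# - 1#) + (m ×′ 1# - n ×′ 1#)          ≈⟨ interchange _ _ _ _ ⟩
    (1# + m ×′ 1#) + (- 1# + - (n ×′ 1#))    ≈⟨ +-cong (≈-sym (1+× m 1#))
      (≈-trans (-‿+-comm _ _) (-‿cong (≈-sym (1+× n 1#)))) ⟩
    suc m ×′ 1# - suc n ×′ 1#                ∎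

  embed-+ : ∀ i j → embed (i ℤ.+ j) ≈ embed i + embed j
  embed-+ (+ m)    (+ n)    = ×-homo-+ 1# m n
  embed-+ (+ m)    -[1+ n ] = embed-⊖ m (suc n)
  embed-+ -[1+ m ] (+ n)    = ≈-trans (embed-⊖ n (suc m)) (+-comm _ _)
  embed-+ -[1+ m ] -[1+ n ] = begin
    - (suc (suc (m ℕ.+ n)) ×′ 1#)        ≡⟨ cong (λ k → - (suc k ×′ 1#)) (ℕ.+-suc m n) ⟨
    - ((suc m ℕ.+ suc n) ×′ 1#)          ≈⟨ -‿cong (×-homo-+ 1# (suc m) (suc n)) ⟩
    - (suc m ×′ 1# + suc n ×′ 1#)        ≈⟨ -‿+-comm _ _ ⟨
    - (suc m ×′ 1#) + - (suc n ×′ 1#)    ∎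

  embed-neg : ∀ i → embed (ℤ.- i) ≈ - embed i
  embed-neg (+ zero)  = ≈-sym -0#≈0#
  embed-neg (+ suc n) = ≈-refl
  embed-neg -[1+ n ]  = ≈-sym (-‿involutive _)

  embed-+◃ : ∀ n → embed (Sign.+ ◃ n) ≈ n ×′ 1#
  embed-+◃ zero    = ≈-refl
  embed-+◃ (suc n) = ≈-refl

  embed-neg◃ : ∀ n → embed (Sign.- ◃ n) ≈ - (n ×′ 1#)
  embed-neg◃ zero    = ≈-sym -0#≈0#
  embed-neg◃ (suc n) = ≈-refl

  embed-* : ∀ i j → embed (i ℤ.* j) ≈ embed i * embed j
  embed-* (+ m)    (+ n)    = ≈-trans (embed-+◃ (m ℕ.* n)) (×1-homo-* m n)
  embed-* (+ m)    -[1+ n ] = ≈-trans (embed-neg◃ (m ℕ.* suc n))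
    (≈-trans (-‿cong (×1-homo-* m (suc n))) (-‿distribʳ-* _ _))
  embed-* -[1+ m ] (+ n)    = ≈-trans (embed-neg◃ (suc m ℕ.* n))
    (≈-trans (-‿cong (×1-homo-* (suc m) n)) (-‿distribˡ-* _ _))
  embed-* -[1+ m ] -[1+ n ] = ≈-trans (embed-+◃ (suc m ℕ.* suc n))
    (≈-trans (×1-homo-* (suc m) (suc n)) (≈-trans (≈-sym (-‿involutive _))
      (≈-trans (-‿cong (-‿distribˡ-* _ _)) (-‿distribʳ-* _ _))))

  ℤ-rawRing : RawRing 0ℓ 0ℓ
  ℤ-rawRing = record
    { Carrier = ℤ ; _≈_ = _≡_ ; _+_ = ℤ._+_ ; _*_ = ℤ._*_ ; -_ = ℤ.-_ ; 0# = + 0 ; 1# = + 1 }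

  morphism : ℤ-rawRing -Raw-AlmostCommutative⟶ fromCommutativeRing R
  morphism = record
    { ⟦_⟧ = embed ; +-homo = embed-+ ; *-homo = embed-* ; -‿homo = embed-neg
    ; 0-homo = ≈-refl ; 1-homo = ≈-refl }

  embed-≟ : ∀ i j → Maybe (embed i ≈ embed j)
  embed-≟ i j = map (λ i≡j → reflexive (cong embed i≡j)) (dec⇒maybe (i ℤ.≟ j))

  open RingSolver ℤ-rawRing (fromCommutativeRing R) morphism embed-≟ public
    using (Polynomial; solve; _:=_; _:+_; _:*_; _:-_; :-_; con)

-- Arithmetic, order and absolute value in an ordered field.

module OrderedField (𝓡 : CompleteOrderedField) where
  open Reals 𝓡
  open CommutativeRing commutativeRing public
    using (-‿inverseʳ; +-identityˡ; +-identityʳ; +-comm;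
           *-identityˡ; *-identityʳ; *-comm; *-assoc; zeroˡ; zeroʳ)
  open IntegerCoefficients commutativeRing public
  open IsDecTotalOrder isDecTotalOrder public
    using ()
    renaming (refl to ≤-refl; trans to ≤-trans; antisym to ≤-antisym;
              total to ≤-total; reflexive to ≤-reflexive)

  totalOrder : TotalOrder 0ℓ 0ℓ 0ℓ
  totalOrder = record { isTotalOrder = IsDecTotalOrder.isTotalOrder isDecTotalOrder }

  open TotalOrder totalOrder using (poset)
  module ≤-Reasoning = PartialOrderReasoning poset
  open MaxConstruct totalOrder public using (_⊔_; x≤y⇒x⊔y≈y; x≤y⇒y⊔x≈y; x≤x⊔y; x≤y⊔x)
  open MinConstruct totalOrder public using (_⊓_; x⊓y≤x; x⊓y≤y; ⊓-sel)

  -- `:2` is spelled the way `fromℕ 2` unfolds, so identities solved with it apply to `fromℕ 2` by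
  -- computation.
  :0 :1 :2 : ∀ {n} → Polynomial n
  :0 = con (ℤ.+ 0)
  :1 = con (ℤ.+ 1)
  :2 = :1 :+ (:1 :+ :0)

  <⇒≤ : ∀ {x y} → x < y → x ≤ y
  <⇒≤ = proj₁

  <⇒≱ : ∀ {x y} → x < y → ¬ (y ≤ x)
  <⇒≱ = NonStrict.<⇒≱ _≡_ _≤_ ≤-antisym

  ≰⇒> : ∀ {x y} → ¬ (x ≤ y) → y < x
  ≰⇒> = NonStrict.≰⇒> _≡_ _≤_ sym ≤-reflexive ≤-total

  <-≤-trans : ∀ {x y z} → x < y → y ≤ z → x < z
  <-≤-trans = NonStrict.<-≤-trans _≡_ _≤_ sym ≤-trans ≤-antisym λ { refl p → p }

  ≤-<-trans : ∀ {x y z} → x ≤ y → y < z → x < z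
  ≤-<-trans = NonStrict.≤-<-trans _≡_ _≤_ ≤-trans ≤-antisym λ { refl p → p }

  -- Reduces an inequality to a ring identity: once a nonnegative gap `z` is named, the equation is
  -- left to the solver.
  ≤-by : ∀ {x y z} → 0# ≤ z → y ≡ x + z → x ≤ y
  ≤-by {x} {y} {z} 0≤z y≡x+z = begin
    x       ≡⟨ +-identityʳ x ⟨
    x + 0#  ≤⟨ +-monoʳ-≤ x 0≤z ⟩
    x + z   ≡⟨ y≡x+z ⟨
    y       ∎
    where open ≤-Reasoning

  x≤y⇒0≤y-x : ∀ {x y} → x ≤ y → 0# ≤ y - x
  x≤y⇒0≤y-x {x} {y} x≤y = begin
    0#        ≡⟨ solve 1 (λ x → :0 := :- x :+ x) refl x ⟩
    - x + x   ≤⟨ +-monoʳ-≤ (- x) x≤y ⟩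
    - x + y   ≡⟨ +-comm _ _ ⟩
    y - x     ∎
    where open ≤-Reasoning

  0≤y-x⇒x≤y : ∀ {x y} → 0# ≤ y - x → x ≤ y
  0≤y-x⇒x≤y {x} {y} p = ≤-by p (solve 2 (λ x y → y := x :+ (y :- x)) refl x y)

  x<y⇒0<y-x : ∀ {x y} → x < y → 0# < y - x
  x<y⇒0<y-x {x} {y} (x≤y , x≢y) = x≤y⇒0≤y-x x≤y , λ 0≡y-x → x≢y (begin
    x           ≡⟨ +-identityˡ x ⟨
    0# + x      ≡⟨ cong (_+ x) 0≡y-x ⟩
    y - x + x   ≡⟨ solve 2 (λ x y → y :- x :+ x := y) refl x y ⟩
    y           ∎)
    where open ≡-Reasoning

  0<y-x⇒x<y : ∀ {x y} → 0# < y - x → x < y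
  0<y-x⇒x<y {x} {y} (0≤y-x , 0≢y-x) = 0≤y-x⇒x≤y 0≤y-x , λ where
    refl → 0≢y-x (solve 1 (λ x → :0 := x :- x) refl x)

  +-mono-≤ : ∀ {x y u v} → x ≤ y → u ≤ v → x + u ≤ y + v
  +-mono-≤ {x} {y} {u} {v} x≤y u≤v = begin
    x + u   ≤⟨ +-monoʳ-≤ x u≤v ⟩
    x + v   ≡⟨ +-comm x v ⟩
    v + x   ≤⟨ +-monoʳ-≤ v x≤y ⟩
    v + y   ≡⟨ +-comm v y ⟩
    y + v   ∎
    where open ≤-Reasoning

  +-mono-<-≤ : ∀ {x y u v} → x < y → u ≤ v → x + u < y + v
  +-mono-<-≤ {x} {y} {u} {v} x<y u≤v = 0<y-x⇒x<y
    (<-≤-trans (x<y⇒0<y-x x<y) (≤-by (x≤y⇒0≤y-x u≤v)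
      (solve 4 (λ x y u v → (y :+ v) :- (x :+ u) := (y :- x) :+ (v :- u)) refl x y u v)))

  0≤+ : ∀ {x y} → 0# ≤ x → 0# ≤ y → 0# ≤ x + y
  0≤+ {x} {y} 0≤x 0≤y = ≤-trans 0≤x (≤-by 0≤y refl)

  *-monoˡ-≤ : ∀ {x y z} → 0# ≤ z → x ≤ y → z * x ≤ z * y
  *-monoˡ-≤ {x} {y} {z} 0≤z x≤y = ≤-by (*-nonNegative 0≤z (x≤y⇒0≤y-x x≤y))
    (solve 3 (λ x y z → z :* y := z :* x :+ z :* (y :- x)) refl x y z)

  *-mono-≤ : ∀ {x y u v} → 0# ≤ x → 0# ≤ u → x ≤ y → u ≤ v → x * u ≤ y * v
  *-mono-≤ {x} {y} {u} {v} 0≤x 0≤u x≤y u≤v = begin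
    x * u   ≤⟨ *-monoˡ-≤ 0≤x u≤v ⟩
    x * v   ≡⟨ *-comm x v ⟩
    v * x   ≤⟨ *-monoˡ-≤ (≤-trans 0≤u u≤v) x≤y ⟩
    v * y   ≡⟨ *-comm v y ⟩
    y * v   ∎
    where open ≤-Reasoning

  0≤x² : ∀ x → 0# ≤ x * x
  0≤x² x with ≤-total 0# x
  ... | inj₁ 0≤x = *-nonNegative 0≤x 0≤x
  ... | inj₂ x≤0 = subst (0# ≤_)
    (solve 1 (λ x → (:0 :- x) :* (:0 :- x) := x :* x) refl x)
    (*-nonNegative (x≤y⇒0≤y-x x≤0) (x≤y⇒0≤y-x x≤0))

  0<1 : 0# < 1#
  0<1 = subst (0# ≤_) (*-identityˡ 1#) (0≤x² 1#) , 0≢1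

  0≤1 : 0# ≤ 1#
  0≤1 = <⇒≤ 0<1

  0≤fromℕ : ∀ n → 0# ≤ fromℕ n
  0≤fromℕ zero    = ≤-refl
  0≤fromℕ (suc n) = 0≤+ 0≤1 (0≤fromℕ n)

  0<1+x : ∀ {x} → 0# ≤ x → 0# < 1# + x
  0<1+x 0≤x = <-≤-trans 0<1 (≤-by 0≤x refl)

  0<fromℕ : ∀ n → .{{NonZero n}} → 0# < fromℕ n
  0<fromℕ (suc n) = 0<1+x (0≤fromℕ n)

  >⇒≢0 : ∀ {x} → 0# < x → x ≢ 0#
  >⇒≢0 (_ , 0≢x) x≡0 = 0≢x (sym x≡0)

  *-inverse : ∀ {x} → 0# < x → x * x ⁻¹ ≡ 1#
  *-inverse 0<x = *-inverseʳ _ (>⇒≢0 0<x)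

  ⁻¹-unique : ∀ {x y} → 0# < x → x * y ≡ 1# → x ⁻¹ ≡ y
  ⁻¹-unique {x} {y} 0<x xy≡1 = begin
    x ⁻¹               ≡⟨ *-identityʳ _ ⟨
    x ⁻¹ * 1#          ≡⟨ cong (x ⁻¹ *_) xy≡1 ⟨
    x ⁻¹ * (x * y)     ≡⟨ solve 3 (λ x x′ y → x′ :* (x :* y) := (x :* x′) :* y) refl x (x ⁻¹) y ⟩
    x * x ⁻¹ * y       ≡⟨ cong (_* y) (*-inverse 0<x) ⟩
    1# * y             ≡⟨ *-identityˡ y ⟩
    y                  ∎
    where open ≡-Reasoning

  *-cancelˡ : ∀ {x y z} → 0# < x → x * y ≡ x * z → y ≡ z
  *-cancelˡ {x} {y} {z} 0<x xy≡xz = begin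
    y                 ≡⟨ cancel y ⟨
    x ⁻¹ * (x * y)    ≡⟨ cong (x ⁻¹ *_) xy≡xz ⟩
    x ⁻¹ * (x * z)    ≡⟨ cancel z ⟩
    z                 ∎
    where
    open ≡-Reasoning
    cancel : ∀ w → x ⁻¹ * (x * w) ≡ w
    cancel w = trans (solve 3 (λ x x′ w → x′ :* (x :* w) := (x :* x′) :* w) refl x (x ⁻¹) w)
                     (trans (cong (_* w) (*-inverse 0<x)) (*-identityˡ w))

  *-positive : ∀ {x y} → 0# < x → 0# < y → 0# < x * y
  *-positive {x} 0<x 0<y = *-nonNegative (<⇒≤ 0<x) (<⇒≤ 0<y) , λ 0≡xy →
    proj₂ 0<y (*-cancelˡ 0<x (trans (zeroʳ x) 0≡xy))

  *-monoˡ-< : ∀ {x y z} → 0# < z → x < y → z * x < z * y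
  *-monoˡ-< 0<z (x≤y , x≢y) = *-monoˡ-≤ (<⇒≤ 0<z) x≤y , λ eq → x≢y (*-cancelˡ 0<z eq)

  ⁻¹-positive : ∀ {x} → 0# < x → 0# < x ⁻¹
  ⁻¹-positive {x} 0<x = ≰⇒> λ x⁻¹≤0 → <⇒≱ 0<1 (begin
    1#          ≡⟨ *-inverse 0<x ⟨
    x * x ⁻¹    ≤⟨ *-monoˡ-≤ (<⇒≤ 0<x) x⁻¹≤0 ⟩
    x * 0#      ≡⟨ zeroʳ x ⟩
    0#          ∎)
    where open ≤-Reasoning

  /-*-cancel : ∀ {x} y → 0# < x → y / x * x ≡ y
  /-*-cancel {x} y 0<x = begin
    y * x ⁻¹ * x      ≡⟨ solve 3 (λ x x′ y → y :* x′ :* x := y :* (x :* x′)) refl x (x ⁻¹) y ⟩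
    y * (x * x ⁻¹)    ≡⟨ cong (y *_) (*-inverse 0<x) ⟩
    y * 1#            ≡⟨ *-identityʳ y ⟩
    y                 ∎
    where open ≡-Reasoning

  /-positive : ∀ {x y} → 0# < x → 0# < y → 0# < x / y
  /-positive 0<x 0<y = *-positive 0<x (⁻¹-positive 0<y)

  ½+½≡1 : ½ + ½ ≡ 1#
  ½+½≡1 = trans (solve 1 (λ h → :1 :* h :+ :1 :* h := :2 :* h) refl (fromℕ 2 ⁻¹)) (*-inverse (0<fromℕ 2))

  0<½ : 0# < ½
  0<½ = /-positive 0<1 (0<fromℕ 2)

  x≡½x+½x : ∀ x → x ≡ ½ * x + ½ * x
  x≡½x+½x x = begin
    x                ≡⟨ *-identityˡ x ⟨
    1# * x           ≡⟨ cong (_* x) ½+½≡1 ⟨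
    (½ + ½) * x      ≡⟨ solve 2 (λ h x → (h :+ h) :* x := h :* x :+ h :* x) refl ½ x ⟩
    ½ * x + ½ * x    ∎
    where open ≡-Reasoning

  -- 1 + D rather than D, which may be 0.
  *-/[1+]-< : ∀ {D ε} → 0# ≤ D → 0# < ε → D * (ε / (1# + D)) < ε
  *-/[1+]-< {D} {ε} 0≤D 0<ε = 0<y-x⇒x<y (subst (0# <_) lemma (/-positive 0<ε (0<1+x 0≤D)))
    where
    lemma : ε / (1# + D) ≡ ε - D * (ε / (1# + D))
    lemma = trans
      (solve 3 (λ e i D → e :* i := e :* i :* (:1 :+ D) :- D :* (e :* i)) refl ε ((1# + D) ⁻¹) D)
      (cong (_- D * (ε / (1# + D))) (/-*-cancel ε (0<1+x 0≤D)))

  ∣∣-< : ∀ {x ε} → x < ε → - x < ε → ∣ x ∣ < ε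
  ∣∣-< {x} p q with 0# ≤? x
  ... | yes _ = p
  ... | no  _ = q

  x≤∣x∣ : ∀ x → x ≤ ∣ x ∣
  x≤∣x∣ x with 0# ≤? x
  ... | yes _   = ≤-refl
  ... | no  0≰x = ≤-trans (<⇒≤ (≰⇒> 0≰x))
    (subst (0# ≤_) (+-identityˡ _) (x≤y⇒0≤y-x (<⇒≤ (≰⇒> 0≰x))))

  -x≤∣x∣ : ∀ x → - x ≤ ∣ x ∣
  -x≤∣x∣ x with 0# ≤? x
  ... | yes 0≤x = ≤-trans (≤-by 0≤x (solve 1 (λ x → :0 := :- x :+ x) refl x)) 0≤x
  ... | no  _   = ≤-refl

  ∣0∣≡0 : ∣ 0# ∣ ≡ 0#
  ∣0∣≡0 with 0# ≤? 0#
  ... | yes _   = refl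
  ... | no  0≰0 = contradiction ≤-refl 0≰0

  𝟏-yes : ∀ {A : Set} (A? : Dec A) → A → 𝟏 A? ≡ 1#
  𝟏-yes A? a rewrite dec-true A? a = refl

  𝟏-no : ∀ {A : Set} (A? : Dec A) → ¬ A → 𝟏 A? ≡ 0#
  𝟏-no A? ¬a rewrite dec-false A? ¬a = refl

  0≤𝟏 : ∀ {A : Set} (A? : Dec A) → 0# ≤ 𝟏 A?
  0≤𝟏 (yes _) = 0≤1
  0≤𝟏 (no  _) = ≤-refl

  x-0≡x : ∀ x → x - 0# ≡ x
  x-0≡x = solve 1 (λ x → x :- :0 := x) refl

  -0≡0 : - 0# ≡ 0#
  -0≡0 = trans (sym (+-identityˡ _)) (x-0≡x 0#)

  ∣∣-+ : ∀ {x y ε} → ∣ x ∣ < ½ * ε → ∣ y ∣ < ½ * ε → ∣ x + y ∣ < ε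
  ∣∣-+ {x} {y} {ε} ∣x∣< ∣y∣< = subst (∣ x + y ∣ <_) (sym (x≡½x+½x ε)) (∣∣-<
    (+-mono-<-≤ (≤-<-trans (x≤∣x∣ x) ∣x∣<) (<⇒≤ (≤-<-trans (x≤∣x∣ y) ∣y∣<)))
    (subst (_< ½ * ε + ½ * ε) (solve 2 (λ x y → :- x :+ :- y := :- (x :+ y)) refl x y)
      (+-mono-<-≤ (≤-<-trans (-x≤∣x∣ x) ∣x∣<) (<⇒≤ (≤-<-trans (-x≤∣x∣ y) ∣y∣<)))))

  ∣∣-* : ∀ {κ x ε} → 0# ≤ κ → 0# < ε → ∣ x ∣ < ε / (1# + κ) → ∣ κ * x ∣ < ε
  ∣∣-* {κ} {x} {ε} 0≤κ 0<ε ∣x∣< = ∣∣-<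
    (≤-<-trans (*-monoˡ-≤ 0≤κ (≤-trans (x≤∣x∣ x) (<⇒≤ ∣x∣<))) (*-/[1+]-< 0≤κ 0<ε))
    (≤-<-trans
      (subst (_≤ κ * (ε / (1# + κ))) (solve 2 (λ κ x → κ :* (:- x) := :- (κ :* x)) refl κ x)
        (*-monoˡ-≤ 0≤κ (≤-trans (-x≤∣x∣ x) (<⇒≤ ∣x∣<))))
      (*-/[1+]-< 0≤κ 0<ε))

  ∣∣-neg : ∀ {x ε} → ∣ x ∣ < ε → ∣ - x ∣ < ε
  ∣∣-neg {x} {ε} ∣x∣< = ∣∣-<
    (≤-<-trans (-x≤∣x∣ x) ∣x∣<)
    (subst (_< ε) (solve 1 (λ x → x := :- (:- x)) refl x) (≤-<-trans (x≤∣x∣ x) ∣x∣<))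

  0<⊓ : ∀ {x y} → 0# < x → 0# < y → 0# < x ⊓ y
  0<⊓ {x} {y} 0<x 0<y with ⊓-sel x y
  ... | inj₁ ≡x = subst (0# <_) (sym ≡x) 0<x
  ... | inj₂ ≡y = subst (0# <_) (sym ≡y) 0<y

-- Riemann integrals: linearity, monotone integrands, improper integrals.

module Integration (𝓡 : CompleteOrderedField) where
  open Fitting 𝓡
  open OrderedField 𝓡
  private module ∑ = SemiringSum semiring

  riemannSum-cong : ∀ {h h′ : ℝ → ℝ} → (∀ x → h x ≡ h′ x) →
    ∀ {p q} (π : TaggedPartition p q) → riemannSum h π ≡ riemannSum h′ π
  riemannSum-cong h≗h′ empty            = refl
  riemannSum-cong h≗h′ (cell t m _ _ π) =
    cong₂ (λ u v → u * _ + v) (h≗h′ t) (riemannSum-cong h≗h′ π)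

  riemannSum-+ : ∀ h h′ {p q} (π : TaggedPartition p q) →
    riemannSum (λ x → h x + h′ x) π ≡ riemannSum h π + riemannSum h′ π
  riemannSum-+ h h′ empty                = sym (+-identityˡ 0#)
  riemannSum-+ h h′ (cell {a} t m _ _ π) = trans
    (cong ((h t + h′ t) * (m - a) +_) (riemannSum-+ h h′ π))
    (solve 5 (λ h h′ w r r′ → (h :+ h′) :* w :+ (r :+ r′) := (h :* w :+ r) :+ (h′ :* w :+ r′)) refl
      (h t) (h′ t) (m - a) (riemannSum h π) (riemannSum h′ π))

  riemannSum-* : ∀ κ h {p q} (π : TaggedPartition p q) →
    riemannSum (λ x → κ * h x) π ≡ κ * riemannSum h π
  riemannSum-* κ h empty                = sym (zeroʳ κ)
  riemannSum-* κ h (cell {a} t m _ _ π) = trans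
    (cong (κ * h t * (m - a) +_) (riemannSum-* κ h π))
    (solve 4 (λ κ h w r → κ :* h :* w :+ κ :* r := κ :* (h :* w :+ r)) refl
      κ (h t) (m - a) (riemannSum h π))

  Finer-mono : ∀ {δ δ′} → δ ≤ δ′ → ∀ {p q} {π : TaggedPartition p q} → Finer δ π → Finer δ′ π
  Finer-mono δ≤δ′ empty      = empty
  Finer-mono δ≤δ′ (cell w f) = cell (<-≤-trans w δ≤δ′) (Finer-mono δ≤δ′ f)

  HasIntegral-cong : ∀ {h h′ : ℝ → ℝ} → (∀ x → h x ≡ h′ x) →
    ∀ {p q I} → HasIntegral h p q I → HasIntegral h′ p q I
  HasIntegral-cong h≗h′ ∫h ε 0<ε =
    let δ , 0<δ , close = ∫h ε 0<ε in
    δ , 0<δ , λ π f →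
    subst (λ r → ∣ r - _ ∣ < ε) (riemannSum-cong h≗h′ π) (close π f)

  HasIntegral-0 : ∀ {p q} → HasIntegral (λ _ → 0#) p q 0#
  HasIntegral-0 ε 0<ε = 1# , 0<1 , λ π _ →
    subst (λ r → ∣ r ∣ < ε) (sym (trans (cong (_- 0#) (riemannSum-0 π)) (-‿inverseʳ 0#)))
      (subst (_< ε) (sym ∣0∣≡0) 0<ε)
    where
    riemannSum-0 : ∀ {p q} (π : TaggedPartition p q) → riemannSum (λ _ → 0#) π ≡ 0#
    riemannSum-0 empty                = refl
    riemannSum-0 (cell {a} t m _ _ π) = trans (cong (0# * (m - a) +_) (riemannSum-0 π))
      (trans (+-identityʳ _) (zeroˡ (m - a)))

  HasIntegral-+ : ∀ {h h′ p q I I′} → HasIntegral h p q I → HasIntegral h′ p q I′ →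
    HasIntegral (λ x → h x + h′ x) p q (I + I′)
  HasIntegral-+ {h} {h′} {p} {q} {I} {I′} ∫h ∫h′ ε 0<ε =
    let δ  , 0<δ  , close  = ∫h  (½ * ε) (*-positive 0<½ 0<ε)
        δ′ , 0<δ′ , close′ = ∫h′ (½ * ε) (*-positive 0<½ 0<ε)
    in δ ⊓ δ′ , 0<⊓ 0<δ 0<δ′ , λ π f →
    subst (λ r → ∣ r ∣ < ε) (sym (regroup π)) (∣∣-+
      (close π (Finer-mono (x⊓y≤x δ δ′) f))
      (close′ π (Finer-mono (x⊓y≤y δ δ′) f)))
    where
    regroup : (π : TaggedPartition p q) → riemannSum (λ x → h x + h′ x) π - (I + I′) ≡
              (riemannSum h π - I) + (riemannSum h′ π - I′)
    regroup π = trans (cong (_- (I + I′)) (riemannSum-+ h h′ π))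
      (solve 4 (λ R R′ I I′ → (R :+ R′) :- (I :+ I′) := (R :- I) :+ (R′ :- I′)) refl
        (riemannSum h π) (riemannSum h′ π) I I′)
  HasIntegral-* : ∀ {κ h p q I} → 0# ≤ κ → HasIntegral h p q I →
    HasIntegral (λ x → κ * h x) p q (κ * I)
  HasIntegral-* {κ} {h} {p} {q} {I} 0≤κ ∫h ε 0<ε =
    let δ , 0<δ , close = ∫h (ε / (1# + κ)) (/-positive 0<ε (0<1+x 0≤κ)) in
    δ , 0<δ , λ π f →
    subst (λ r → ∣ r ∣ < ε) (sym (regroup π)) (∣∣-* 0≤κ 0<ε (close π f))
    where
    regroup : (π : TaggedPartition p q) →
      riemannSum (λ x → κ * h x) π - κ * I ≡ κ * (riemannSum h π - I)
    regroup π = trans (cong (_- κ * I) (riemannSum-* κ h π))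
      (solve 3 (λ κ R I → κ :* R :- κ :* I := κ :* (R :- I)) refl κ (riemannSum h π) I)

  HasIntegral-neg : ∀ {h p q I} → HasIntegral h p q I → HasIntegral (λ x → - h x) p q (- I)
  HasIntegral-neg {h} {p} {q} {I} ∫h ε 0<ε =
    let δ , 0<δ , close = ∫h ε 0<ε in
    δ , 0<δ , λ π f →
    subst (λ r → ∣ r ∣ < ε) (sym (regroup π)) (∣∣-neg (close π f))
    where
    riemannSum-neg : ∀ {p q} (π : TaggedPartition p q) →
      riemannSum (λ x → - h x) π ≡ - riemannSum h π
    riemannSum-neg empty                = sym -0≡0
    riemannSum-neg (cell {a} t m _ _ π) = trans
      (cong (- h t * (m - a) +_) (riemannSum-neg π))
      (solve 3 (λ h w r → :- h :* w :+ :- r := :- (h :* w :+ r)) refl (h t) (m - a) (riemannSum h π))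

    regroup : (π : TaggedPartition p q) →
      riemannSum (λ x → - h x) π - - I ≡ - (riemannSum h π - I)
    regroup π = trans (cong (_- - I) (riemannSum-neg π))
      (solve 2 (λ R I → :- R :- :- I := :- (R :- I)) refl (riemannSum h π) I)

  HasIntegral-∑ : ∀ {N p q} (κ : Fin N → ℝ) (h : Fin N → ℝ → ℝ) (I : Fin N → ℝ) →
    (∀ n → 0# ≤ κ n) → (∀ n → HasIntegral (h n) p q (I n)) →
    HasIntegral (λ x → ∑ (λ n → κ n * h n x)) p q (∑ (λ n → κ n * I n))
  HasIntegral-∑ {zero}  κ h I 0≤κ ∫h = HasIntegral-0
  HasIntegral-∑ {suc N} κ h I 0≤κ ∫h = HasIntegral-+ (HasIntegral-* (0≤κ zero) (∫h zero))
    (HasIntegral-∑ (λ n → κ (suc n)) (λ n → h (suc n)) (λ n → I (suc n))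
      (λ n → 0≤κ (suc n)) (λ n → ∫h (suc n)))

  -- The cell bounds of G telescope, so a Riemann sum of mesh δ is off by at most
  -- δ (h q - h p), and jumps of h need no separate treatment.
  HasIntegral-monotone : ∀ {h G : ℝ → ℝ} → (∀ {x y} → x ≤ y → h x ≤ h y) →
    (∀ {x y} → x ≤ y → h x * (y - x) ≤ G y - G x) →
    (∀ {x y} → x ≤ y → G y - G x ≤ h y * (y - x)) →
    ∀ {p q} → p ≤ q → HasIntegral h p q (G q - G p)
  HasIntegral-monotone {h} {G} mono lower upper {p} {q} p≤q ε 0<ε =
    ε / (1# + D) , 0<δ , λ π f → ∣∣-<
      (≤-<-trans (proj₁ (error π f)) Dδ<ε)
      (≤-<-trans (proj₂ (error π f)) Dδ<ε)
    where
    D = h q - h p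
    δ = ε / (1# + D)
    0≤D : 0# ≤ D
    0≤D = x≤y⇒0≤y-x (mono p≤q)
    0<δ : 0# < δ
    0<δ = /-positive 0<ε (0<1+x 0≤D)
    Dδ<ε : D * δ < ε
    Dδ<ε = *-/[1+]-< 0≤D 0<ε

    error : ∀ {p q} (π : TaggedPartition p q) → Finer δ π →
      (riemannSum h π - (G q - G p) ≤ (h q - h p) * δ) ×
      (- (riemannSum h π - (G q - G p)) ≤ (h q - h p) * δ)
    error {p} empty empty =
      ≤-reflexive (solve 3 (λ g h d → :0 :- (g :- g) := (h :- h) :* d) refl (G p) (h p) δ) ,
      ≤-reflexive (solve 3 (λ g h d → :- (:0 :- (g :- g)) := (h :- h) :* d) refl (G p) (h p) δ)
    error {p} {q} (cell t m p≤t t≤m π) (cell w f) =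
      subst₂ _≤_
        (solve 5 (λ ht R Gq Gp Gm → (ht :- (Gm :- Gp)) :+ (R :- (Gq :- Gm)) := (ht :+ R) :- (Gq :- Gp))
          refl (h t * (m - p)) (riemannSum h π) (G q) (G p) (G m)) split
        (+-mono-≤ (≤-trans above within) (proj₁ (error π f))) ,
      subst₂ _≤_
        (solve 5 (λ ht R Gq Gp Gm → :- (ht :- (Gm :- Gp)) :+ :- (R :- (Gq :- Gm)) := :- ((ht :+ R) :- (Gq :- Gp)))
          refl (h t * (m - p)) (riemannSum h π) (G q) (G p) (G m)) split
        (+-mono-≤ (≤-trans below within) (proj₂ (error π f)))
      where
      p≤m = ≤-trans p≤t t≤m
      0≤m-p = x≤y⇒0≤y-x p≤m
      split : (h m - h p) * δ + (h q - h m) * δ ≡ (h q - h p) * δ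
      split = solve 4 (λ u v w d → (v :- u) :* d :+ (w :- v) :* d := (w :- u) :* d) refl (h p) (h m) (h q) δ
      within : (h m - h p) * (m - p) ≤ (h m - h p) * δ
      within = *-monoˡ-≤ (x≤y⇒0≤y-x (mono p≤m)) (<⇒≤ w)
      -- Both `h t * (m - p)` and `G m - G p` lie between `h p * (m - p)` and `h m * (m - p)`.
      -- `above` takes the upper bound of the first and the lower bound of the second, `below` the
      -- opposite pair.
      above : h t * (m - p) - (G m - G p) ≤ (h m - h p) * (m - p)
      above = 0≤y-x⇒x≤y (subst (0# ≤_)
        (solve 5 (λ ht hm hp w g → (hm :- ht) :* w :+ (g :- hp :* w) := (hm :- hp) :* w :- (ht :* w :- g)) refl
          (h t) (h m) (h p) (m - p) (G m - G p))
        (0≤+ (*-nonNegative (x≤y⇒0≤y-x (mono t≤m)) 0≤m-p) (x≤y⇒0≤y-x (lower p≤m))))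
      below : - (h t * (m - p) - (G m - G p)) ≤ (h m - h p) * (m - p)
      below = 0≤y-x⇒x≤y (subst (0# ≤_)
        (solve 5 (λ ht hm hp w g → (ht :- hp) :* w :+ (hm :* w :- g) := (hm :- hp) :* w :- (:- (ht :* w :- g))) refl
          (h t) (h m) (h p) (m - p) (G m - G p))
        (0≤+ (*-nonNegative (x≤y⇒0≤y-x (mono p≤t)) 0≤m-p) (x≤y⇒0≤y-x (upper p≤m))))

  -- Step functions on finitely many boxes vanish beyond the last right end, so the integrals over
  -- `[p , r]` become constant in `r` and the limit needs no estimate.
  HasIntegral∞-eventually : ∀ {h p I} (J : ℝ → ℝ) → (∀ r → p ≤ r → HasIntegral h p r (J r)) →
    ∀ M → (∀ r → M ≤ r → J r ≡ I) → HasIntegral∞ h p I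
  HasIntegral∞-eventually {I = I} J ∫h M J≡I = J , ∫h , λ ε 0<ε → M , λ r _ M≤r →
    subst (λ j → ∣ j - I ∣ < ε) (sym (J≡I r M≤r))
      (subst (_< ε) (sym (trans (cong ∣_∣ (-‿inverseʳ I)) ∣0∣≡0)) 0<ε)

  upperBound : ∀ {N} (u : Fin N → ℝ) → ∃[ M ] (∀ n → u n ≤ M)
  upperBound {zero}  u = 0# , λ ()
  upperBound {suc N} u with upperBound (λ n → u (suc n))
  ... | M , u≤M = u zero ⊔ M , λ where
    zero    → x≤x⊔y (u zero) M
    (suc n) → ≤-trans (u≤M n) (x≤y⊔x (u zero) M)

  -- Integrals of a nonnegative affine function cut off to an interval.

  module AffinePieces (α β : ℝ) (0≤α : 0# ≤ α) (0≤β : 0# ≤ β) where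

    -- The mean uses three instances: `1`, `x` and `τ + x`.
    affine : ℝ → ℝ
    affine x = α + β * x

    antiderivative : ℝ → ℝ
    antiderivative x = α * x + ½ * β * (x * x)

    affine-mono : ∀ {x y} → x ≤ y → affine x ≤ affine y
    affine-mono x≤y = +-monoʳ-≤ α (*-monoˡ-≤ 0≤β x≤y)

    0≤affine : ∀ {x} → 0# ≤ x → 0# ≤ affine x
    0≤affine 0≤x = 0≤+ 0≤α (*-nonNegative 0≤β 0≤x)

    private
      halve : ∀ x y → (½ + ½) * x + y ≡ x + y
      halve x y = cong (_+ y) (trans (cong (_* x) ½+½≡1) (*-identityˡ x))

    0≤½β[y-x]² : ∀ x y → 0# ≤ ½ * β * ((y - x) * (y - x))
    0≤½β[y-x]² x y = *-nonNegative (*-nonNegative (<⇒≤ 0<½) 0≤β) (0≤x² (y - x))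

    -- The gap is exactly `½ * β * ((y - x) * (y - x))`. To the solver `½` is an atom, so the
    -- identity is first proved with a factor `½ + ½`, which `halve` then removes.
    antiderivative-lower : ∀ x y → affine x * (y - x) ≤ antiderivative y - antiderivative x
    antiderivative-lower x y = ≤-by (0≤½β[y-x]² x y) (begin
      antiderivative y - antiderivative x
        ≡⟨ solve 5 (λ α β h x y →
             (α :* y :+ h :* β :* (y :* y)) :- (α :* x :+ h :* β :* (x :* x)) :=
             (h :+ h) :* (β :* x :* (y :- x)) :+ (α :* (y :- x) :+ h :* β :* ((y :- x) :* (y :- x))))
             refl α β ½ x y ⟩
      (½ + ½) * (β * x * (y - x)) + (α * (y - x) + ½ * β * ((y - x) * (y - x)))
        ≡⟨ halve _ _ ⟩
      β * x * (y - x) + (α * (y - x) + ½ * β * ((y - x) * (y - x)))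
        ≡⟨ solve 5 (λ α β x w s → β :* x :* w :+ (α :* w :+ s) := (α :+ β :* x) :* w :+ s)
             refl α β x (y - x) (½ * β * ((y - x) * (y - x))) ⟩
      affine x * (y - x) + ½ * β * ((y - x) * (y - x)) ∎)
      where open ≡-Reasoning

    -- This is `antiderivative-lower` with its arguments swapped, negated: that bound holds for both
    -- orders of `x` and `y`.
    antiderivative-upper : ∀ x y → antiderivative y - antiderivative x ≤ affine y * (y - x)
    antiderivative-upper x y = subst₂ _≤_
      (solve 2 (λ u v → :- (u :- v) := v :- u) refl (antiderivative x) (antiderivative y))
      (solve 3 (λ a x y → :- (a :* (x :- y)) := a :* (y :- x)) refl (affine y) x y)
      (neg-mono (antiderivative-lower y x))
      where
      neg-mono : ∀ {u v} → u ≤ v → - v ≤ - u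
      neg-mono {u} {v} u≤v = ≤-by (x≤y⇒0≤y-x u≤v) (solve 2 (λ u v → :- u := :- v :+ (v :- u)) refl u v)

    ramp : ℝ → ℝ → ℝ
    ramp l x = affine x * 𝟏 (l ≤? x)

    ramp-≥ : ∀ {l x} → l ≤ x → ramp l x ≡ affine x
    ramp-≥ {l} {x} l≤x = trans (cong (affine x *_) (𝟏-yes (l ≤? x) l≤x)) (*-identityʳ _)

    ramp-< : ∀ {l x} → ¬ l ≤ x → ramp l x ≡ 0#
    ramp-< {l} {x} l≰x = trans (cong (affine x *_) (𝟏-no (l ≤? x) l≰x)) (zeroʳ _)

    ramp-mono : ∀ {l} → 0# ≤ l → ∀ {x y} → x ≤ y → ramp l x ≤ ramp l y
    ramp-mono {l} 0≤l {x} {y} x≤y = go (l ≤? x) (l ≤? y)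
      where
      go : Dec (l ≤ x) → Dec (l ≤ y) → ramp l x ≤ ramp l y
      go (yes p) _       = subst₂ _≤_ (sym (ramp-≥ p)) (sym (ramp-≥ (≤-trans p x≤y))) (affine-mono x≤y)
      go (no  p) (yes q) = subst₂ _≤_ (sym (ramp-< p)) (sym (ramp-≥ q)) (0≤affine (≤-trans 0≤l q))
      go (no  p) (no  q) = ≤-reflexive (trans (ramp-< p) (sym (ramp-< q)))

    -- Replacing `x` by `l ⊔ x` freezes the antiderivative to the left of `l`, where the ramp is
    -- zero. The jump at `l` does no harm, because `HasIntegral-monotone` asks only for bounds on
    -- differences, not for a derivative.
    HasIntegral-ramp : ∀ {l} → 0# ≤ l → ∀ {p q} → p ≤ q →
      HasIntegral (ramp l) p q (antiderivative (l ⊔ q) - antiderivative (l ⊔ p))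
    HasIntegral-ramp {l} 0≤l = HasIntegral-monotone (ramp-mono 0≤l) lower upper
      where
      G : ℝ → ℝ
      G x = antiderivative (l ⊔ x)
      G-≥ : ∀ {x} → l ≤ x → G x ≡ antiderivative x
      G-≥ l≤x = cong antiderivative (x≤y⇒x⊔y≈y l≤x)
      G-< : ∀ {x} → ¬ l ≤ x → G x ≡ antiderivative l
      G-< l≰x = cong antiderivative (x≤y⇒y⊔x≈y (<⇒≤ (≰⇒> l≰x)))
      0≤w : ∀ {x y} → x ≤ y → 0# ≤ y - x
      0≤w = x≤y⇒0≤y-x
      flat : ∀ {x y} → G x ≡ antiderivative l → G y ≡ antiderivative l → G y - G x ≡ 0#
      flat gx gy = trans (cong₂ _-_ gy gx) (-‿inverseʳ (antiderivative l))
      zero-* : ∀ {x} → ¬ l ≤ x → ∀ w → ramp l x * w ≡ 0#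
      zero-* l≰x w = trans (cong (_* w) (ramp-< l≰x)) (zeroˡ w)
      0≤rise : ∀ {y} → l ≤ y → 0# ≤ antiderivative y - antiderivative l
      0≤rise {y} l≤y = ≤-trans (*-nonNegative (0≤affine 0≤l) (0≤w l≤y)) (antiderivative-lower l y)

      lower : ∀ {x y} → x ≤ y → ramp l x * (y - x) ≤ G y - G x
      lower {x} {y} x≤y = go (l ≤? x) (l ≤? y)
        where
        go : Dec (l ≤ x) → Dec (l ≤ y) → ramp l x * (y - x) ≤ G y - G x
        go (yes l≤x) _         = subst₂ _≤_
          (cong (_* (y - x)) (sym (ramp-≥ l≤x)))
          (sym (cong₂ _-_ (G-≥ (≤-trans l≤x x≤y)) (G-≥ l≤x)))
          (antiderivative-lower x y)
        go (no  l≰x) (yes l≤y) = subst₂ _≤_ (sym (zero-* l≰x _))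
          (sym (cong₂ _-_ (G-≥ l≤y) (G-< l≰x))) (0≤rise l≤y)
        go (no  l≰x) (no  l≰y) = ≤-reflexive
          (trans (zero-* l≰x _) (sym (flat (G-< l≰x) (G-< l≰y))))

      upper : ∀ {x y} → x ≤ y → G y - G x ≤ ramp l y * (y - x)
      upper {x} {y} x≤y = go (l ≤? x) (l ≤? y)
        where
        go : Dec (l ≤ x) → Dec (l ≤ y) → G y - G x ≤ ramp l y * (y - x)
        go (yes l≤x) _         = subst₂ _≤_
          (sym (cong₂ _-_ (G-≥ (≤-trans l≤x x≤y)) (G-≥ l≤x)))
          (cong (_* (y - x)) (sym (ramp-≥ (≤-trans l≤x x≤y))))
          (antiderivative-upper x y)
        -- Only `[l , y]` contributes. Its length is at most `y - x`, and `affine y` is nonnegative,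
        -- so the bound on `[l , y]` may be widened.
        go (no  l≰x) (yes l≤y) = subst₂ _≤_
          (sym (cong₂ _-_ (G-≥ l≤y) (G-< l≰x)))
          (cong (_* (y - x)) (sym (ramp-≥ l≤y)))
          (≤-trans (antiderivative-upper l y) (*-monoˡ-≤ (0≤affine (≤-trans 0≤l l≤y))
            (≤-by (x≤y⇒0≤y-x (<⇒≤ (≰⇒> l≰x)))
              (solve 3 (λ l x y → y :- x := (y :- l) :+ (l :- x)) refl l x y))))
        go (no  l≰x) (no  l≰y) = ≤-reflexive
          (trans (flat (G-< l≰x) (G-< l≰y)) (sym (zero-* l≰y _)))

    piece : ℝ → ℝ → ℝ → ℝ
    piece l u x = affine x * 𝟏 (inInterval? l u x)

    piece≡ramp-ramp : ∀ {l u} → l < u → ∀ x → ramp l x + - ramp u x ≡ piece l u x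
    piece≡ramp-ramp {l} {u} l<u x = trans
      (solve 3 (λ w s t → w :* s :+ :- (w :* t) := w :* (s :- t)) refl
        (affine x) (𝟏 (l ≤? x)) (𝟏 (u ≤? x)))
      (cong (affine x *_) (go (l ≤? x) (u ≤? x)))
      where
      go : Dec (l ≤ x) → Dec (u ≤ x) → 𝟏 (l ≤? x) - 𝟏 (u ≤? x) ≡ 𝟏 (inInterval? l u x)
      go _         (yes u≤x) = trans
        (cong₂ _-_ (𝟏-yes (l ≤? x) (≤-trans (<⇒≤ l<u) u≤x)) (𝟏-yes (u ≤? x) u≤x))
        (trans (-‿inverseʳ 1#)
          (sym (𝟏-no (inInterval? l u x) λ (_ , x<u) → <⇒≱ x<u u≤x)))
      go (yes l≤x) (no  u≰x) = trans
        (cong₂ _-_ (𝟏-yes (l ≤? x) l≤x) (𝟏-no (u ≤? x) u≰x))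
        (trans (x-0≡x 1#)
          (sym (𝟏-yes (inInterval? l u x) (l≤x , ≰⇒> u≰x))))
      go (no  l≰x) (no  u≰x) = trans
        (cong₂ _-_ (𝟏-no (l ≤? x) l≰x) (𝟏-no (u ≤? x) u≰x))
        (trans (-‿inverseʳ 0#)
          (sym (𝟏-no (inInterval? l u x) λ (l≤x , _) → l≰x l≤x)))

    -- The tail integral of `piece l u` over `[x , ∞)`. An integral over `[p , q]` is then a
    -- difference of two tails, and the improper integral from `p` is a single one.
    integralFrom : ℝ → ℝ → ℝ → ℝ
    integralFrom l u x = antiderivative (u ⊔ x) - antiderivative (l ⊔ x)

    HasIntegral-piece : ∀ {l u} → 0# ≤ l → l < u → ∀ {p q} → p ≤ q →
      HasIntegral (piece l u) p q (integralFrom l u p - integralFrom l u q)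
    HasIntegral-piece {l} {u} 0≤l l<u {p} {q} p≤q =
      HasIntegral-cong (piece≡ramp-ramp l<u)
        (subst (HasIntegral _ p q)
          (solve 4 (λ lq lp uq up → (lq :- lp) :+ :- (uq :- up) := (up :- lp) :- (uq :- lq)) refl
            (antiderivative (l ⊔ q)) (antiderivative (l ⊔ p)) (antiderivative (u ⊔ q)) (antiderivative (u ⊔ p)))
          (HasIntegral-+ (HasIntegral-ramp 0≤l p≤q)
            (HasIntegral-neg (HasIntegral-ramp (≤-trans 0≤l (<⇒≤ l<u)) p≤q))))

    integralFrom-≤ : ∀ {l u x} → x ≤ l → l < u → integralFrom l u x ≡ antiderivative u - antiderivative l
    integralFrom-≤ x≤l l<u = cong₂ (λ s t → antiderivative s - antiderivative t)
      (x≤y⇒y⊔x≈y (≤-trans x≤l (<⇒≤ l<u))) (x≤y⇒y⊔x≈y x≤l)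

    0≤integralFrom : ∀ {l u} → 0# ≤ l → l < u → 0# ≤ integralFrom l u 0#
    0≤integralFrom {l} {u} 0≤l l<u = subst (0# ≤_) (sym (integralFrom-≤ 0≤l l<u)) (≤-trans
      (*-nonNegative (0≤affine 0≤l) (x≤y⇒0≤y-x (<⇒≤ l<u))) (antiderivative-lower l u))

    integralFrom-inside : ∀ {l u x} → l ≤ x → x ≤ u → integralFrom l u x ≡ antiderivative u - antiderivative x
    integralFrom-inside l≤x x≤u = cong₂ (λ s t → antiderivative s - antiderivative t)
      (x≤y⇒y⊔x≈y x≤u) (x≤y⇒x⊔y≈y l≤x)

    integralFrom-≥ : ∀ {l u x} → l < u → u ≤ x → integralFrom l u x ≡ 0#
    integralFrom-≥ {x = x} l<u u≤x = trans
      (cong₂ (λ s t → antiderivative s - antiderivative t)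
        (x≤y⇒x⊔y≈y u≤x) (x≤y⇒x⊔y≈y (≤-trans (<⇒≤ l<u) u≤x)))
      (-‿inverseʳ (antiderivative x))

    HasIntegral∞-pieces : ∀ {N} (l u κ : Fin N → ℝ) → (∀ n → 0# ≤ l n) → (∀ n → l n < u n) →
      (∀ n → 0# ≤ κ n) → ∀ {h : ℝ → ℝ} → (∀ x → ∑ (λ n → κ n * piece (l n) (u n) x) ≡ h x) →
      ∀ p → HasIntegral∞ h p (∑ (λ n → κ n * integralFrom (l n) (u n) p))
    HasIntegral∞-pieces l u κ 0≤l l<u 0≤κ ∑≡h p = HasIntegral∞-eventually
      (λ r → ∑ (λ n → κ n * (integralFrom (l n) (u n) p - integralFrom (l n) (u n) r)))
      (λ r p≤r → HasIntegral-cong ∑≡h (HasIntegral-∑ κ _ _ 0≤κ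
        (λ n → HasIntegral-piece (0≤l n) (l<u n) p≤r)))
      -- Beyond a common bound of all right ends every tail is zero.
      (proj₁ (upperBound u))
      (λ r M≤r → ∑.sum-cong-≗ λ n → cong (κ n *_) (trans
        (cong (λ w → integralFrom (l n) (u n) p - w)
          (integralFrom-≥ (l<u n) (≤-trans (proj₂ (upperBound u) n) M≤r)))
        (x-0≡x (integralFrom (l n) (u n) p))))

-- Regrouping a sum by classes in a commutative monoid, and counting.

module ClassSums {a} (M : CommutativeMonoid a 0ℓ) where
  open CommutativeMonoid M renaming (refl to ≈-refl; sym to ≈-sym; trans to ≈-trans)
  open MonoidSum M
  open RawMonoidDefinitions rawMonoid using () renaming (_×_ to _·_)
  open import Relation.Binary.Reasoning.Setoid setoid

  sum-ε : ∀ {n} (f : Fin n → Carrier) → (∀ i → f i ≈ ε) → sum f ≈ ε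
  sum-ε {n} f f≈ε = ≈-trans (sum-cong-≋ f≈ε) (sum-replicate-zero n)

  sum-single : ∀ {n} i (f : Fin n → Carrier) → (∀ j → j ≢ i → f j ≈ ε) → sum f ≈ f i
  sum-single zero    f f≈ε = ≈-trans (∙-congˡ (sum-ε (f ∘ suc) λ j → f≈ε (suc j) λ ())) (identityʳ _)
  sum-single (suc i) f f≈ε = ≈-trans
    (∙-cong (f≈ε zero λ ()) (sum-single i (f ∘ suc) λ j j≢i → f≈ε (suc j) λ { refl → j≢i refl }))
    (identityˡ _)

  -- Each new data point contributes a family that is `ε` outside the class of that point, so it
  -- raises one count by 1. Both readings of the monoid are used: multiplicatively `_·_` is the
  -- power in the product form of the likelihood, additively it is the weight `S n` in a sum over
  -- the data.
  sum-by-class : ∀ {A : Set} {N P} {Q : Fin N → A → Set} (Q? : ∀ n → Decidable (Q n))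
    (xs : Fin P → A) (c : Fin P → Fin N) →
    (∀ m → Q (c m) (xs m)) → (∀ m n → Q n (xs m) → n ≡ c m) →
    ∀ g → sum (g ∘ c) ≈ sum (λ n → Vec.count (Q? n) (Vec.tabulate xs) · g n)
  sum-by-class {N = N} {P = zero}  Q? xs c _ _ g = ≈-sym (sum-ε {N} (λ _ → ε) λ _ → ≈-refl)
  sum-by-class {N = N} {P = suc P} Q? xs c Qc unique g = begin
    g (c zero) ∙ sum (g ∘ c ∘ suc)
      ≈⟨ ∙-congˡ (sum-by-class Q? (xs ∘ suc) (c ∘ suc) (Qc ∘ suc) (unique ∘ suc) g) ⟩
    g (c zero) ∙ sum rest
      ≡⟨ cong (_∙ sum rest) (cong (if_then g (c zero) else ε) (dec-true (Q? (c zero) x) (Qc zero))) ⟨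
    first (c zero) ∙ sum rest
      ≈⟨ ∙-congʳ (sum-single (c zero) first λ n n≢ →
           reflexive (cong (if_then g n else ε) (dec-false (Q? n x) (n≢ ∘ unique zero n)))) ⟨
    sum first ∙ sum rest
      ≈⟨ ∑-distrib-+ first rest ⟨
    sum (λ n → first n ∙ rest n)
      ≈⟨ sum-cong-≋ count-∷ ⟩
    sum (λ n → Vec.count (Q? n) (Vec.tabulate xs) · g n) ∎
    where
    x = xs zero
    first rest : Fin N → Carrier
    first n = if does (Q? n x) then g n else ε
    rest  n = Vec.count (Q? n) (Vec.tabulate (xs ∘ suc)) · g n
    count-∷ : ∀ n → first n ∙ rest n ≈ Vec.count (Q? n) (Vec.tabulate xs) · g n
    count-∷ n with does (Q? n x)
    ... | true  = ≈-refl
    ... | false = identityˡ _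

module _ {A : Set} {Q : A → Set} (Q? : Decidable Q) where

  count-positive : ∀ {P} (xs : Fin P → A) m → Q (xs m) → 0 ℕ.< Vec.count Q? (Vec.tabulate xs)
  count-positive xs zero Qx rewrite dec-true (Q? (xs zero)) Qx = s≤s z≤n
  count-positive xs (suc m) Qx with does (Q? (xs zero))
  ... | true  = s≤s z≤n
  ... | false = count-positive (xs ∘ suc) m Qx

  count-positive⁻¹ : ∀ {P} (xs : Fin P → A) → 0 ℕ.< Vec.count Q? (Vec.tabulate xs) → ∃[ m ] Q (xs m)
  count-positive⁻¹ {suc P} xs 0<count with Q? (xs zero)
  ... | yes Qx = zero , Qx
  ... | no  _  = let m , Qx = count-positive⁻¹ (xs ∘ suc) 0<count in suc m , Qx

-- Monotonicity of finite sums and products, and the AM-GM inequality.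

module FiniteSumsAndProducts (𝓡 : CompleteOrderedField) where
  open Reals 𝓡
  open OrderedField 𝓡
  private
    module ∑ = SemiringSum semiring
    module ∏ = MonoidSum *-commutativeMonoid
  open SemiringMult semiring using (×-assoc-*)
  open RawMonoidDefinitions +-rawMonoid using () renaming (_×_ to _·_)

  ∑-mono-≤ : ∀ {n} {x y : Fin n → ℝ} → (∀ i → x i ≤ y i) → ∑ x ≤ ∑ y
  ∑-mono-≤ {zero}  x≤y = ≤-refl
  ∑-mono-≤ {suc n} x≤y = +-mono-≤ (x≤y zero) (∑-mono-≤ (x≤y ∘ suc))

  ∑-mono-< : ∀ {n} {x y : Fin n → ℝ} → (∀ i → x i ≤ y i) → ∀ i → x i < y i → ∑ x < ∑ y
  ∑-mono-< x≤y zero    x<y = +-mono-<-≤ x<y (∑-mono-≤ (x≤y ∘ suc))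
  ∑-mono-< x≤y (suc i) x<y = subst₂ _<_ (+-comm _ _) (+-comm _ _)
    (+-mono-<-≤ (∑-mono-< (x≤y ∘ suc) i x<y) (x≤y zero))

  ∑-≤-≡⇒≡ : ∀ {n} {x y : Fin n → ℝ} → (∀ i → x i ≤ y i) → ∑ x ≡ ∑ y → ∀ i → x i ≡ y i
  ∑-≤-≡⇒≡ {x = x} {y} x≤y ∑≡ i = decidable-stable (x i ≟ y i) λ x≢y →
    proj₂ (∑-mono-< x≤y i (x≤y i , x≢y)) ∑≡

  0≤∑ : ∀ {n} {x : Fin n → ℝ} → (∀ i → 0# ≤ x i) → 0# ≤ ∑ x
  0≤∑ {zero}  0≤x = ≤-refl
  0≤∑ {suc n} 0≤x = 0≤+ (0≤x zero) (0≤∑ (0≤x ∘ suc))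

  0≤∏ : ∀ {n} {x : Fin n → ℝ} → (∀ i → 0# ≤ x i) → 0# ≤ ∏ x
  0≤∏ {zero}  0≤x = 0≤1
  0≤∏ {suc n} 0≤x = *-nonNegative (0≤x zero) (0≤∏ (0≤x ∘ suc))

  0<∏ : ∀ {n} {x : Fin n → ℝ} → (∀ i → 0# < x i) → 0# < ∏ x
  0<∏ {zero}  0<x = 0<1
  0<∏ {suc n} 0<x = *-positive (0<x zero) (0<∏ (0<x ∘ suc))

  ∏-mono-≤ : ∀ {n} {x y : Fin n → ℝ} → (∀ i → 0# ≤ x i) → (∀ i → x i ≤ y i) → ∏ x ≤ ∏ y
  ∏-mono-≤ {zero}  0≤x x≤y = ≤-refl
  ∏-mono-≤ {suc n} 0≤x x≤y =
    *-mono-≤ (0≤x zero) (0≤∏ (0≤x ∘ suc)) (x≤y zero) (∏-mono-≤ (0≤x ∘ suc) (x≤y ∘ suc))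

  -- A single zero factor would erase the strict inequality, hence the positivity of every `y i`.
  ∏-mono-< : ∀ {n} {x y : Fin n → ℝ} → (∀ i → 0# ≤ x i) → (∀ i → x i ≤ y i) →
    (∀ i → 0# < y i) → ∀ i → x i < y i → ∏ x < ∏ y
  ∏-mono-< 0≤x x≤y 0<y zero    x<y = ≤-<-trans
    (*-monoˡ-≤ (0≤x zero) (∏-mono-≤ (0≤x ∘ suc) (x≤y ∘ suc)))
    (subst₂ _<_ (*-comm _ _) (*-comm _ _) (*-monoˡ-< (0<∏ (0<y ∘ suc)) x<y))
  ∏-mono-< 0≤x x≤y 0<y (suc i) x<y = ≤-<-trans
    (*-mono-≤ (0≤x zero) (0≤∏ (0≤x ∘ suc)) (x≤y zero) ≤-refl)
    (*-monoˡ-< (0<y zero) (∏-mono-< (0≤x ∘ suc) (x≤y ∘ suc) (0<y ∘ suc) i x<y))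

  ·≡fromℕ-* : ∀ n x → n · x ≡ fromℕ n * x
  ·≡fromℕ-* n x = trans (cong (n ·_) (sym (*-identityˡ x))) (sym (×-assoc-* n 1# x))

  ∑-replicate : ∀ n x → ∑ {n} (λ _ → x) ≡ fromℕ n * x
  ∑-replicate n x = trans (∑.sum-replicate n) (·≡fromℕ-* n x)

  0≤^ : ∀ {x} n → 0# ≤ x → 0# ≤ x ^ n
  0≤^ zero    0≤x = 0≤1
  0≤^ (suc n) 0≤x = *-nonNegative 0≤x (0≤^ n 0≤x)

  ^-mono-≤ : ∀ {x y} n → 0# ≤ x → x ≤ y → x ^ n ≤ y ^ n
  ^-mono-≤ zero    0≤x x≤y = ≤-refl
  ^-mono-≤ (suc n) 0≤x x≤y = *-mono-≤ 0≤x (0≤^ n 0≤x) x≤y (^-mono-≤ n 0≤x x≤y)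

  1^n≡1 : ∀ n → 1# ^ n ≡ 1#
  1^n≡1 zero    = refl
  1^n≡1 (suc n) = trans (*-identityˡ _) (1^n≡1 n)

  -- Powers preserve the order of nonnegative numbers, so the two factors never have opposite signs.
  0≤[a-b][aⁿ-bⁿ] : ∀ {a b} n → 0# ≤ a → 0# ≤ b → 0# ≤ (a - b) * (a ^ n - b ^ n)
  0≤[a-b][aⁿ-bⁿ] {a} {b} n 0≤a 0≤b with ≤-total b a
  ... | inj₁ b≤a = *-nonNegative (x≤y⇒0≤y-x b≤a) (x≤y⇒0≤y-x (^-mono-≤ n 0≤b b≤a))
  ... | inj₂ a≤b = subst (0# ≤_)
    (solve 4 (λ a b x y → (b :- a) :* (y :- x) := (a :- b) :* (x :- y)) refl a b (a ^ n) (b ^ n))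
    (*-nonNegative (x≤y⇒0≤y-x a≤b) (x≤y⇒0≤y-x (^-mono-≤ n 0≤a a≤b)))

  -- AM-GM for one number `a ^ suc n` and `n` copies of `b ^ suc n`, free of roots. In the induction
  -- the new gap is `b` times the old gap plus `(a - b) * (a ^ suc n - b ^ suc n)`, with `n` the
  -- index of the old gap.
  weighted-AM-GM : ∀ {a b} n → 0# ≤ a → 0# ≤ b →
    fromℕ (suc n) * (a * b ^ n) ≤ a ^ suc n + fromℕ n * b ^ suc n
  weighted-AM-GM {a} {b} zero 0≤a 0≤b = ≤-reflexive
    (solve 2 (λ a b → (:1 :+ :0) :* (a :* :1) := a :* :1 :+ :0 :* (b :* :1)) refl a b)
  weighted-AM-GM {a} {b} (suc n) 0≤a 0≤b = ≤-by
    (0≤+ (*-nonNegative 0≤b (x≤y⇒0≤y-x (weighted-AM-GM {a} {b} n 0≤a 0≤b)))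
         (0≤[a-b][aⁿ-bⁿ] {a} {b} (suc n) 0≤a 0≤b))
    (solve 5 (λ a b k x y →
      a :* (a :* x) :+ (:1 :+ k) :* (b :* (b :* y)) :=
      (:1 :+ (:1 :+ k)) :* (a :* (b :* y)) :+
        (b :* ((a :* x :+ k :* (b :* y)) :- (:1 :+ k) :* (a :* y)) :+
         (a :- b) :* (a :* x :- b :* y)))
      refl a b (fromℕ n) (a ^ n) (b ^ n))

  mean : ∀ {n} (x : Fin n → ℝ) → (∀ i → 0# ≤ x i) → ∃[ A ] (0# ≤ A × ∑ x ≡ fromℕ n * A)
  -- Any value would serve as the mean of an empty family; `0#` is a nonnegative one.
  mean {zero}  x 0≤x = 0# , ≤-refl , sym (zeroʳ 0#)
  mean {suc n} x 0≤x = ∑ x / fromℕ (suc n) ,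
    *-nonNegative (0≤∑ 0≤x) (<⇒≤ (⁻¹-positive (0<fromℕ (suc n)))) ,
    trans (sym (/-*-cancel (∑ x) (0<fromℕ (suc n)))) (*-comm _ _)

  -- With `A′` the mean of the tail, the head is at most `fromℕ (suc n) * A - fromℕ n * A′`.
  -- Multiplied by `A′ ^ n`, this bound is at most `A ^ suc n` by `weighted-AM-GM` for `A` and `A′`.
  AM-GM : ∀ {n} (x : Fin n → ℝ) {A} → (∀ i → 0# ≤ x i) → 0# ≤ A → ∑ x ≤ fromℕ n * A → ∏ x ≤ A ^ n
  AM-GM {zero}  x         0≤x 0≤A ∑x≤ = ≤-refl
  AM-GM {suc n} x {A = A} 0≤x 0≤A ∑x≤ = begin
    x zero * ∏ (x ∘ suc)
      ≤⟨ *-monoˡ-≤ (0≤x zero) (AM-GM (x ∘ suc) (0≤x ∘ suc) 0≤A′ (≤-reflexive ∑≡)) ⟩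
    x zero * A′ ^ n
      ≤⟨ ≤-by (*-nonNegative (0≤^ n 0≤A′) (x≤y⇒0≤y-x ∑x≤′))
           (solve 5 (λ x k a b c →
             (:1 :+ k) :* (a :* c) :- k :* (b :* c) := x :* c :+ c :* ((:1 :+ k) :* a :- (x :+ k :* b)))
             refl (x zero) (fromℕ n) A A′ (A′ ^ n)) ⟩
    fromℕ (suc n) * (A * A′ ^ n) - fromℕ n * (A′ ^ suc n)
      ≤⟨ ≤-by (x≤y⇒0≤y-x (weighted-AM-GM {A} {A′} n 0≤A 0≤A′))
           (solve 3 (λ u v w → u := (w :- v) :+ ((u :+ v) :- w)) refl
             (A ^ suc n) (fromℕ n * A′ ^ suc n) (fromℕ (suc n) * (A * A′ ^ n))) ⟩
    A ^ suc n ∎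
    where
    open ≤-Reasoning
    m = mean (x ∘ suc) (0≤x ∘ suc)
    A′ = proj₁ m
    0≤A′ = proj₁ (proj₂ m)
    ∑≡ = proj₂ (proj₂ m)
    ∑x≤′ : x zero + fromℕ n * A′ ≤ fromℕ (suc n) * A
    ∑x≤′ = subst (λ s → x zero + s ≤ fromℕ (suc n) * A) ∑≡ ∑x≤

  0<x² : ∀ {x} → x ≢ 0# → 0# < x * x
  0<x² {x} x≢0 = 0≤x² x , λ 0≡x² → x≢0 (begin
    x                  ≡⟨ *-identityʳ x ⟨
    x * 1#             ≡⟨ cong (x *_) (*-inverseʳ x x≢0) ⟨
    x * (x * x ⁻¹)     ≡⟨ *-assoc x x (x ⁻¹) ⟨
    x * x * x ⁻¹       ≡⟨ cong (_* x ⁻¹) 0≡x² ⟨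
    0# * x ⁻¹          ≡⟨ zeroˡ _ ⟩
    0#                 ∎)
    where open ≡-Reasoning

  midpoint²≡ : ∀ x y → ½ * (x + y) * (½ * (x + y)) ≡ x * y + ½ * (x - y) * (½ * (x - y))
  midpoint²≡ x y = trans
    (solve 3 (λ h x y → h :* (x :+ y) :* (h :* (x :+ y)) :=
      (h :+ h) :* (h :+ h) :* (x :* y) :+ h :* (x :- y) :* (h :* (x :- y))) refl ½ x y)
    (cong (_+ ½ * (x - y) * (½ * (x - y)))
      (trans (cong (λ t → t * t * (x * y)) ½+½≡1)
        (trans (cong (_* (x * y)) (*-identityˡ 1#)) (*-identityˡ _))))

  xy≤midpoint² : ∀ x y → x * y ≤ ½ * (x + y) * (½ * (x + y))
  xy≤midpoint² x y = ≤-by (0≤x² (½ * (x - y))) (midpoint²≡ x y)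

  xy<midpoint² : ∀ {x y} → x ≢ y → x * y < ½ * (x + y) * (½ * (x + y))
  xy<midpoint² {x} {y} x≢y = xy≤midpoint² x y , λ xy≡ → proj₂ (0<x² half≢0) (begin
    0#                          ≡⟨ -‿inverseʳ (x * y) ⟨
    x * y - x * y               ≡⟨ cong (_- x * y) (trans xy≡ (midpoint²≡ x y)) ⟩
    x * y + s - x * y           ≡⟨ solve 2 (λ p s → p :+ s :- p := s) refl (x * y) s ⟩
    s                           ∎)
    where
    open ≡-Reasoning
    s = ½ * (x - y) * (½ * (x - y))
    half≢0 : ½ * (x - y) ≢ 0#
    half≢0 eq = x≢y (begin
      x             ≡⟨ solve 2 (λ x y → x := (x :- y) :+ y) refl x y ⟩
      x - y + y     ≡⟨ cong (_+ y) (*-cancelˡ 0<½ (trans eq (sym (zeroʳ ½)))) ⟩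
      0# + y        ≡⟨ +-identityˡ y ⟩
      y             ∎)

  -- The shape of meanFormula, before and after the sums over boxes are merged.
  combination : ℝ → ℝ → ℝ → ℝ → ℝ → ℝ → ℝ → ℝ → ℝ → ℝ
  combination p q r x₁ x₂ x₃ x₄ x₅ x₆ =
    - (p * x₁) + q * (x₂ + x₃) + r * x₄ + r * x₅ + r * x₆

  combination-∑ : ∀ p q r {N} (x₁ x₂ x₃ x₄ x₅ x₆ : Fin N → ℝ) →
    combination p q r (∑ x₁) (∑ x₂) (∑ x₃) (∑ x₄) (∑ x₅) (∑ x₆) ≡
    ∑ (λ n → combination p q r (x₁ n) (x₂ n) (x₃ n) (x₄ n) (x₅ n) (x₆ n))
  combination-∑ p q r {zero}  _ _ _ _ _ _ =
    solve 3 (λ p q r → :- (p :* :0) :+ q :* (:0 :+ :0) :+ r :* :0 :+ r :* :0 :+ r :* :0 := :0) refl p q r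
  combination-∑ p q r {suc N} x₁ x₂ x₃ x₄ x₅ x₆ = trans
    (combination-+ (x₁ zero) (x₂ zero) (x₃ zero) (x₄ zero) (x₅ zero) (x₆ zero)
      (∑ (x₁ ∘ suc)) (∑ (x₂ ∘ suc)) (∑ (x₃ ∘ suc)) (∑ (x₄ ∘ suc)) (∑ (x₅ ∘ suc)) (∑ (x₆ ∘ suc)))
    (cong (combination p q r (x₁ zero) (x₂ zero) (x₃ zero) (x₄ zero) (x₅ zero) (x₆ zero) +_)
      (combination-∑ p q r (x₁ ∘ suc) (x₂ ∘ suc) (x₃ ∘ suc) (x₄ ∘ suc) (x₅ ∘ suc) (x₆ ∘ suc)))
    where
    combination-+ : ∀ x₁ x₂ x₃ x₄ x₅ x₆ y₁ y₂ y₃ y₄ y₅ y₆ →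
      combination p q r (x₁ + y₁) (x₂ + y₂) (x₃ + y₃) (x₄ + y₄) (x₅ + y₅) (x₆ + y₆) ≡
      combination p q r x₁ x₂ x₃ x₄ x₅ x₆ + combination p q r y₁ y₂ y₃ y₄ y₅ y₆
    combination-+ x₁ x₂ x₃ x₄ x₅ x₆ y₁ y₂ y₃ y₄ y₅ y₆ =
      solve 15 (λ p q r x₁ x₂ x₃ x₄ x₅ x₆ y₁ y₂ y₃ y₄ y₅ y₆ →
        :- (p :* (x₁ :+ y₁)) :+ q :* ((x₂ :+ y₂) :+ (x₃ :+ y₃)) :+
          r :* (x₄ :+ y₄) :+ r :* (x₅ :+ y₅) :+ r :* (x₆ :+ y₆) :=
        (:- (p :* x₁) :+ q :* (x₂ :+ x₃) :+ r :* x₄ :+ r :* x₅ :+ r :* x₆) :+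
        (:- (p :* y₁) :+ q :* (y₂ :+ y₃) :+ r :* y₄ :+ r :* y₅ :+ r :* y₆))
        refl p q r x₁ x₂ x₃ x₄ x₅ x₆ y₁ y₂ y₃ y₄ y₅ y₆

-- The likelihood, its maximum and the uniqueness of the maximizer.

module MaximumLikelihood (𝓡 : CompleteOrderedField) {N P : ℕ} .{{_ : NonZero P}}
  (B : Fin N → Fitting.Box 𝓡) (disjoint : Fitting.PairwiseDisjoint 𝓡 B)
  (xs : Fin P → Fitting.ℝ 𝓡 × Fitting.ℝ 𝓡)
  (covered : ∀ m → ∃[ n ] Fitting.InBox 𝓡 (B n) (xs m)) where

  open Fitting 𝓡
  open Model B
  open Likelihood xs
  open OrderedField 𝓡
  open FiniteSumsAndProducts 𝓡
  private
    module ∑ where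
      open SemiringSum semiring public
      open ClassSums (CommutativeRing.+-commutativeMonoid commutativeRing) public
    module ∏ where
      open MonoidSum *-commutativeMonoid public
      open ClassSums *-commutativeMonoid public

  box : Fin P → Fin N
  box m = proj₁ (covered m)

  inBox : ∀ m → InBox (B (box m)) (xs m)
  inBox m = proj₂ (covered m)

  box-unique : ∀ m n → InBox (B n) (xs m) → n ≡ box m
  box-unique m n n∋x = decidable-stable (n Fin.≟ box m) λ n≢ →
    disjoint n (box m) n≢ (xs m) (n∋x , inBox m)

  density≡ : ∀ k m → density k (proj₁ (xs m)) (proj₂ (xs m)) ≡ k (box m)
  density≡ k m = trans (∑.sum-single (box m) term off) on
    where
    x = proj₁ (xs m)
    y = proj₂ (xs m)
    u v term : Fin N → ℝ
    u n = 𝟏 (inInterval? (a n) (b n) x)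
    v n = 𝟏 (inInterval? (c n) (d n) y)
    term n = k n * u n * v n
    on : term (box m) ≡ k (box m)
    on = trans (cong₂ (λ s t → k (box m) * s * t)
        (𝟏-yes (inInterval? _ _ x) (proj₁ (inBox m))) (𝟏-yes (inInterval? _ _ y) (proj₂ (inBox m))))
      (trans (*-identityʳ _) (*-identityʳ _))
    off : ∀ n → n ≢ box m → term n ≡ 0#
    off n n≢ = go (inInterval? (a n) (b n) x) (inInterval? (c n) (d n) y)
      where
      go : Dec (InInterval (a n) (b n) x) → Dec (InInterval (c n) (d n) y) → term n ≡ 0#
      go _       (no ¬q) = trans (cong (k n * u n *_) (𝟏-no (inInterval? _ _ y) ¬q)) (zeroʳ _)
      go (no ¬p) _       = trans (cong (λ s → k n * s * v n) (𝟏-no (inInterval? _ _ x) ¬p))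
        (trans (cong (_* v n) (zeroʳ (k n))) (zeroˡ (v n)))
      go (yes p) (yes q) = contradiction (box-unique m n (p , q)) n≢

  likelihood≡∏ : ∀ k → likelihood k ≡ ∏ (k ∘ box)
  likelihood≡∏ k = ∏.sum-cong-≗ (density≡ k)

  likelihood≡ : ∀ k → likelihood k ≡ ∏ (λ n → k n ^ S n)
  likelihood≡ k = trans (likelihood≡∏ k) (∏.sum-by-class (inBox? ∘ B) xs box inBox box-unique k)

  ∑-box : ∀ g → ∑ (g ∘ box) ≡ ∑ (λ n → fromℕ (S n) * g n)
  ∑-box g = trans (∑.sum-by-class (inBox? ∘ B) xs box inBox box-unique g)
    (∑.sum-cong-≗ λ n → ·≡fromℕ-* (S n) (g n))

  ∑S≡P : ∑ (λ n → fromℕ (S n)) ≡ fromℕ P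
  ∑S≡P = begin
    ∑ (λ n → fromℕ (S n))           ≡⟨ ∑.sum-cong-≗ (λ n → *-identityʳ (fromℕ (S n))) ⟨
    ∑ (λ n → fromℕ (S n) * 1#)      ≡⟨ ∑-box (λ _ → 1#) ⟨
    ∑ {P} (λ _ → 1#)                ≡⟨ ∑-replicate P 1# ⟩
    fromℕ P * 1#                    ≡⟨ *-identityʳ _ ⟩
    fromℕ P                         ∎
    where open ≡-Reasoning

  area : Fin N → ℝ
  area n = (b n - a n) * (d n - c n)

  0<area : ∀ n → 0# < area n
  0<area n = *-positive (x<y⇒0<y-x (a<b n)) (x<y⇒0<y-x (c<d n))

  0<P : 0# < fromℕ P
  0<P = 0<fromℕ P

  0<scale : ∀ n → 0# < fromℕ P * (b n - a n) * (d n - c n)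
  0<scale n = *-positive (*-positive 0<P (x<y⇒0<y-x (a<b n))) (x<y⇒0<y-x (c<d n))

  scale≡ : ∀ n → fromℕ P * (b n - a n) * (d n - c n) ≡ fromℕ P * area n
  scale≡ n = *-assoc _ _ _

  fitted-* : ∀ n → fitted n * (fromℕ P * area n) ≡ fromℕ (S n)
  fitted-* n = trans (cong (fitted n *_) (sym (scale≡ n))) (/-*-cancel (fromℕ (S n)) (0<scale n))

  0≤fitted : ∀ n → 0# ≤ fitted n
  0≤fitted n = *-nonNegative (0≤fromℕ (S n)) (<⇒≤ (⁻¹-positive (0<scale n)))

  0<fitted : ∀ n → 0 ℕ.< S n → 0# < fitted n
  0<fitted n 0<S = /-positive (0<fromℕ (S n) {{ℕ.>-nonZero 0<S}}) (0<scale n)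

  0<fitted-box : ∀ m → 0# < fitted (box m)
  0<fitted-box m = 0<fitted (box m) (count-positive (inBox? (B (box m))) xs m (inBox m))

  mass≡ : ∀ (k : Fin N → ℝ) → ∑ (λ n → k n * (b n - a n) * (d n - c n)) ≡ ∑ (λ n → k n * area n)
  mass≡ k = ∑.sum-cong-≗ λ n → *-assoc (k n) (b n - a n) (d n - c n)

  fitted-normalized : Normalized fitted
  fitted-normalized = trans (mass≡ fitted) (*-cancelˡ 0<P (begin
    fromℕ P * ∑ (λ n → fitted n * area n)      ≡⟨ ∑.*-distribˡ-sum (fromℕ P) (λ n → fitted n * area n) ⟩
    ∑ (λ n → fromℕ P * (fitted n * area n))    ≡⟨ ∑.sum-cong-≗ (λ n → trans
      (solve 3 (λ p f w → p :* (f :* w) := f :* (p :* w)) refl (fromℕ P) (fitted n) (area n)) (fitted-* n)) ⟩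
    ∑ (λ n → fromℕ (S n))                      ≡⟨ ∑S≡P ⟩
    fromℕ P                                    ≡⟨ *-identityʳ _ ⟨
    fromℕ P * 1#                               ∎))
    where open ≡-Reasoning

  fitted-admissible₀ : Admissible₀ fitted
  fitted-admissible₀ = 0≤fitted , fitted-normalized

  ∏≤∏fitted : ∀ k → Admissible₀ k → ∏ (k ∘ box) ≤ ∏ (fitted ∘ box)
  ∏≤∏fitted k (0≤k , normalized) = begin
    ∏ (k ∘ box)                              ≡⟨ ∏.sum-cong-≗ (λ m → /-*-cancel (k (box m)) (0<fitted-box m)) ⟨
    ∏ (λ m → r (box m) * fitted (box m))     ≡⟨ ∏.∑-distrib-+ (r ∘ box) (fitted ∘ box) ⟩
    ∏ (r ∘ box) * ∏ (fitted ∘ box)           ≤⟨ *-mono-≤ (0≤∏ 0≤r) (0≤∏ (0≤fitted ∘ box)) ∏r≤1 ≤-refl ⟩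
    1# * ∏ (fitted ∘ box)                    ≡⟨ *-identityˡ _ ⟩
    ∏ (fitted ∘ box)                         ∎
    where
    open ≤-Reasoning
    r : Fin N → ℝ
    r n = k n / fitted n
    0≤r : ∀ m → 0# ≤ r (box m)
    0≤r m = *-nonNegative (0≤k (box m)) (<⇒≤ (⁻¹-positive (0<fitted-box m)))
    -- In a box without data the ratio divides by `fitted n`, which is 0, but there the weight `S n`
    -- is 0 too and only the nonnegativity of the right side remains. In every other box equality
    -- holds.
    S*r≤ : ∀ n → fromℕ (S n) * r n ≤ fromℕ P * (k n * area n)
    S*r≤ n = go (S n) refl
      where
      go : ∀ s → s ≡ S n → fromℕ (S n) * r n ≤ fromℕ P * (k n * area n)
      go zero    0≡S = subst (_≤ fromℕ P * (k n * area n))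
        (sym (trans (cong (λ s → fromℕ s * r n) (sym 0≡S)) (zeroˡ (r n))))
        (*-nonNegative (<⇒≤ 0<P) (*-nonNegative (0≤k n) (<⇒≤ (0<area n))))
      go (suc _) S≡  = ≤-reflexive (trans (cong (_* r n) (sym (fitted-* n))) (trans
        (solve 4 (λ f p w r → f :* (p :* w) :* r := p :* (r :* f :* w)) refl (fitted n) (fromℕ P) (area n) (r n))
        (cong (λ t → fromℕ P * (t * area n))
          (/-*-cancel (k n) (0<fitted n (subst (0 ℕ.<_) S≡ (s≤s z≤n)))))))
    ∏r≤1 : ∏ (r ∘ box) ≤ 1#
    ∏r≤1 = subst (∏ (r ∘ box) ≤_) (1^n≡1 P) (AM-GM (r ∘ box) 0≤r 0≤1 (begin
      ∑ (r ∘ box)                            ≡⟨ ∑-box r ⟩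
      ∑ (λ n → fromℕ (S n) * r n)            ≤⟨ ∑-mono-≤ S*r≤ ⟩
      ∑ (λ n → fromℕ P * (k n * area n))     ≡⟨ ∑.*-distribˡ-sum (fromℕ P) (λ n → k n * area n) ⟨
      fromℕ P * ∑ (λ n → k n * area n)       ≡⟨ cong (fromℕ P *_) (trans (sym (mass≡ k)) normalized) ⟩
      fromℕ P * 1#                           ∎))

  likelihood≤ : ∀ k → Admissible₀ k → likelihood k ≤ likelihood fitted
  likelihood≤ k adm = subst₂ _≤_ (sym (likelihood≡∏ k)) (sym (likelihood≡∏ fitted)) (∏≤∏fitted k adm)

  midpoint : (Fin N → ℝ) → Fin N → ℝ
  midpoint k n = ½ * (k n + fitted n)

  midpoint-normalized : ∀ k → Normalized k → Normalized (midpoint k)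
  midpoint-normalized k normalized = begin
    ∑ (λ n → midpoint k n * (b n - a n) * (d n - c n))
      ≡⟨ ∑.sum-cong-≗ (λ n → solve 5 (λ h k f u v →
             h :* (k :+ f) :* u :* v := h :* (k :* u :* v :+ f :* u :* v))
           refl ½ (k n) (fitted n) (b n - a n) (d n - c n)) ⟩
    ∑ (λ n → ½ * (mass k n + mass fitted n))
      ≡⟨ ∑.*-distribˡ-sum ½ (λ n → mass k n + mass fitted n) ⟨
    ½ * ∑ (λ n → mass k n + mass fitted n)
      ≡⟨ cong (½ *_) (∑.∑-distrib-+ (mass k) (mass fitted)) ⟩
    ½ * (∑ (mass k) + ∑ (mass fitted))
      ≡⟨ cong₂ (λ s t → ½ * (s + t)) normalized fitted-normalized ⟩
    ½ * (1# + 1#)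
      ≡⟨ solve 1 (λ h → h :* (:1 :+ :1) := h :+ h) refl ½ ⟩
    ½ + ½
      ≡⟨ ½+½≡1 ⟩
    1# ∎
    where
    open ≡-Reasoning
    mass : (Fin N → ℝ) → Fin N → ℝ
    mass k n = k n * (b n - a n) * (d n - c n)

  midpoint-admissible : ∀ k → Admissible k → Admissible (midpoint k)
  midpoint-admissible k (0<k , normalized) =
    (λ n → *-positive 0<½ (<-≤-trans (0<k n) (≤-by (0≤fitted n) refl))) , midpoint-normalized k normalized

  midpoint-admissible₀ : ∀ k → Admissible₀ k → Admissible₀ (midpoint k)
  midpoint-admissible₀ k (0≤k , normalized) =
    (λ n → *-nonNegative (<⇒≤ 0<½) (0≤+ (0≤k n) (0≤fitted n))) , midpoint-normalized k normalized

  -- ∏ k ∏ fitted ≤ (∏ midpoint)² ≤ (∏ k)² ≤ ∏ k ∏ fitted, and the first inequality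
  -- is strict unless k and fitted agree at every data point.
  midpoint-≤⇒≡-box : ∀ k → Admissible₀ k → likelihood (midpoint k) ≤ likelihood k →
    ∀ m → k (box m) ≡ fitted (box m)
  midpoint-≤⇒≡-box k adm@(0≤k , _) mid≤k m = decidable-stable (k (box m) ≟ fitted (box m)) λ k≢f →
    <⇒≱ (begin-strict
      ∏ (k ∘ box) * ∏ (fitted ∘ box)
        ≡⟨ ∏.∑-distrib-+ (k ∘ box) (fitted ∘ box) ⟨
      ∏ (λ i → k (box i) * fitted (box i))
        <⟨ ∏-mono-< (λ i → *-nonNegative (0≤k (box i)) (0≤fitted (box i)))
             (λ i → xy≤midpoint² (k (box i)) (fitted (box i)))
             (λ i → *-positive (0<mid i) (0<mid i)) m (xy<midpoint² k≢f) ⟩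
      ∏ (λ i → mid i * mid i)
        ≡⟨ ∏.∑-distrib-+ mid mid ⟩
      ∏ mid * ∏ mid ∎)
    -- One factor `∏ mid` is bounded by the product of `k`, the other by that of `fitted`.
    (*-mono-≤ (0≤∏ (<⇒≤ ∘ 0<mid)) (0≤∏ (<⇒≤ ∘ 0<mid)) mid≤ (≤-trans mid≤ (∏≤∏fitted k adm)))
    where
    open ≤-Reasoning
    mid : Fin P → ℝ
    mid i = midpoint k (box i)
    -- `k` may vanish here, but the fitted coefficient of a box holding a data point is positive.
    -- This supplies the positivity that `∏-mono-<` asks for.
    0<mid : ∀ i → 0# < mid i
    0<mid i = *-positive 0<½ (<-≤-trans (0<fitted-box i) (≤-by (0≤k (box i)) (+-comm _ _)))
    mid≤ : ∏ mid ≤ ∏ (k ∘ box)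
    mid≤ = subst₂ _≤_ (likelihood≡∏ (midpoint k)) (likelihood≡∏ k) mid≤k

  -- In boxes with data the two agree, and in the others the fit is 0, so `fitted` is at most `k`
  -- everywhere. As both have total mass 1 and every area is positive, no inequality can be strict.
  midpoint-≤⇒≡ : ∀ k → Admissible₀ k → likelihood (midpoint k) ≤ likelihood k → ∀ n → k n ≡ fitted n
  midpoint-≤⇒≡ k adm@(0≤k , normalized) mid≤k n =
    *-cancelˡ (0<area n) (sym (∑-≤-≡⇒≡ (λ i → *-monoˡ-≤ (<⇒≤ (0<area i)) (fitted≤k i)) ∑≡ n))
    where
    fitted≤k : ∀ i → fitted i ≤ k i
    fitted≤k i = go (S i) refl
      where
      go : ∀ s → s ≡ S i → fitted i ≤ k i
      go zero    0≡S = subst (_≤ k i)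
        (sym (trans (cong (λ s → fromℕ s / (fromℕ P * (b i - a i) * (d i - c i))) (sym 0≡S)) (zeroˡ _)))
        (0≤k i)
      go (suc _) S≡  =
        let m , i∋x = count-positive⁻¹ (inBox? (B i)) xs (subst (0 ℕ.<_) S≡ (s≤s z≤n)) in
        subst (λ j → fitted j ≤ k j) (sym (box-unique m i i∋x))
          (≤-reflexive (sym (midpoint-≤⇒≡-box k adm mid≤k m)))
    ∑-area : ∀ k → Normalized k → ∑ (λ i → area i * k i) ≡ 1#
    ∑-area k normalized = trans
      (∑.sum-cong-≗ (λ i → *-comm (area i) (k i))) (trans (sym (mass≡ k)) normalized)
    ∑≡ : ∑ (λ i → area i * fitted i) ≡ ∑ (λ i → area i * k i)
    ∑≡ = trans (∑-area fitted fitted-normalized) (sym (∑-area k normalized))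

  admissible⇒admissible₀ : ∀ k → Admissible k → Admissible₀ k
  admissible⇒admissible₀ k (0<k , normalized) = <⇒≤ ∘ 0<k , normalized

  -- If some box holds no data, its fitted coefficient 0 contradicts `Admissible k`, and the lemma
  -- then says that `Admissible` contains no maximizer.
  maximizer≡fitted : ∀ k → Maximizes Admissible k → ∀ n → k n ≡ fitted n
  maximizer≡fitted k (adm , max) =
    midpoint-≤⇒≡ k (admissible⇒admissible₀ k adm) (max (midpoint k) (midpoint-admissible k adm))

  maximizer₀≡fitted : ∀ k → Maximizes Admissible₀ k → ∀ n → k n ≡ fitted n
  maximizer₀≡fitted k (adm , max) = midpoint-≤⇒≡ k adm (max (midpoint k) (midpoint-admissible₀ k adm))

  fitted-maximizes : (∀ n → 0 ℕ.< S n) → Maximizes Admissible fitted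
  fitted-maximizes 0<S = ((λ n → 0<fitted n (0<S n)) , fitted-normalized) ,
    λ k adm → likelihood≤ k (admissible⇒admissible₀ k adm)

  fitted-maximizes₀ : Maximizes Admissible₀ fitted
  fitted-maximizes₀ = fitted-admissible₀ , likelihood≤

-- The mean of the derived time, box by box.

module DerivedMean (𝓡 : CompleteOrderedField) {N : ℕ} (B : Fin N → Fitting.Box 𝓡)
  (τ : Fitting.ℝ 𝓡) (0≤τ : Fitting._≤_ 𝓡 (Fitting.0# 𝓡) τ) where

  open Fitting 𝓡
  open Model B
  open OrderedField 𝓡
  open Integration 𝓡
  open FiniteSumsAndProducts 𝓡
  private
    module ∑ = SemiringSum semiring
    module One = AffinePieces 1# 0# 0≤1 ≤-refl
    module Id  = AffinePieces 0# 1# ≤-refl 0≤1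
    module τ+  = AffinePieces τ 1# 0≤τ 0≤1

  -- The share of one box with coefficient `k`. The first product is the integral of `x` over the
  -- part of the box to the left of `τ`, the second that of `τ + y` over the part to the right; each
  -- factors because the density is constant on the box.
  boxMean : ℝ → Fin N → ℝ
  boxMean k n =
    k * One.integralFrom (c n) (d n) 0# * (Id.integralFrom (a n) (b n) 0# - Id.integralFrom (a n) (b n) τ) +
    k * τ+.integralFrom (c n) (d n) 0# * One.integralFrom (a n) (b n) τ

  module _ (k : Fin N → ℝ) (0≤k : ∀ n → 0# ≤ k n) where

    private
      u v : Fin N → ℝ → ℝ
      u n x = 𝟏 (inInterval? (a n) (b n) x)
      v n y = 𝟏 (inInterval? (c n) (d n) y)

      width weight : Fin N → ℝ
      width  n = One.integralFrom (c n) (d n) 0#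
      weight n = τ+.integralFrom (c n) (d n) 0#

      inner₁ inner₂ : ℝ → ℝ
      inner₁ x = ∑ (λ n → x * (k n * u n x) * width n)
      inner₂ x = ∑ (λ n → k n * u n x * weight n)

      I₁ I₂ : ℝ
      I₁ = ∑ (λ n → k n * width n * (Id.integralFrom (a n) (b n) 0# - Id.integralFrom (a n) (b n) τ))
      I₂ = ∑ (λ n → k n * weight n * One.integralFrom (a n) (b n) τ)

    derivedTimeHasMean : DerivedTimeHasMean (density k) τ (∑ (λ n → boxMean (k n) n))
    derivedTimeHasMean =
      I₁ , I₂ ,
      (inner₁ ,
        -- For the inner integral the factor `x` is a constant and joins the coefficients, which
        -- must be nonnegative. For the outer integral it is the integrand, and the coefficients are
        -- `k n * width n`.
        (λ x 0≤x _ → One.HasIntegral∞-pieces c d (λ n → x * (k n * u n x)) 0≤c c<d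
          (λ n → *-nonNegative 0≤x (*-nonNegative (0≤k n) (0≤u n x)))
          (λ y → trans
            (∑.sum-cong-≗ λ n → solve 5 (λ x y k u v →
                x :* (k :* u) :* ((:1 :+ :0 :* y) :* v) := x :* (k :* u :* v))
              refl x y (k n) (u n x) (v n y))
            (sym (∑.*-distribˡ-sum x (λ n → k n * u n x * v n y))))
          0#) ,
        HasIntegral-cong
          (λ x → ∑.sum-cong-≗ λ n →
            solve 4 (λ x k u w → k :* w :* ((:0 :+ :1 :* x) :* u) := x :* (k :* u) :* w)
              refl x (k n) (u n x) (width n))
          (HasIntegral-∑ (λ n → k n * width n) (λ n → Id.piece (a n) (b n)) _
            (λ n → *-nonNegative (0≤k n) (One.0≤integralFrom (0≤c n) (c<d n)))
            (λ n → Id.HasIntegral-piece (0≤a n) (a<b n) 0≤τ))) ,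
      (inner₂ ,
        (λ x _ → τ+.HasIntegral∞-pieces c d (λ n → k n * u n x) 0≤c c<d
          (λ n → *-nonNegative (0≤k n) (0≤u n x))
          (λ y → trans
            (∑.sum-cong-≗ λ n → solve 5 (λ τ y k u v →
                k :* u :* ((τ :+ :1 :* y) :* v) := (τ :+ y) :* (k :* u :* v))
              refl τ y (k n) (u n x) (v n y))
            (sym (∑.*-distribˡ-sum (τ + y) (λ n → k n * u n x * v n y))))
          0#) ,
        One.HasIntegral∞-pieces a b (λ n → k n * weight n) 0≤a a<b
          (λ n → *-nonNegative (0≤k n) (τ+.0≤integralFrom (0≤c n) (c<d n)))
          (λ x → ∑.sum-cong-≗ λ n →
            solve 4 (λ x k u w → k :* w :* ((:1 :+ :0 :* x) :* u) := k :* u :* w)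
              refl x (k n) (u n x) (weight n))
          τ) ,
      ∑.∑-distrib-+
        (λ n → k n * width n * (Id.integralFrom (a n) (b n) 0# - Id.integralFrom (a n) (b n) τ))
        (λ n → k n * weight n * One.integralFrom (a n) (b n) τ)
      where
      0≤u : ∀ n x → 0# ≤ u n x
      0≤u n x = 0≤𝟏 (inInterval? (a n) (b n) x)

  width≡ : ∀ n → One.integralFrom (c n) (d n) 0# ≡ d n - c n
  width≡ n = trans (One.integralFrom-≤ (0≤c n) (c<d n))
    (solve 3 (λ h c d → (:1 :* d :+ h :* :0 :* (d :* d)) :- (:1 :* c :+ h :* :0 :* (c :* c)) := d :- c)
      refl ½ (c n) (d n))

  weight≡ : ∀ n → τ+.integralFrom (c n) (d n) 0# ≡ (d n - c n) * (τ + ½ * (d n + c n))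
  weight≡ n = trans (τ+.integralFrom-≤ (0≤c n) (c<d n))
    (solve 4 (λ h τ c d → (τ :* d :+ h :* :1 :* (d :* d)) :- (τ :* c :+ h :* :1 :* (c :* c)) :=
        (d :- c) :* (τ :+ h :* (d :+ c)))
      refl ½ τ (c n) (d n))

  module _ (k : ℝ) (n : Fin N) where

    private
      boxMean≡ : ∀ {t₀ t s} → Id.integralFrom (a n) (b n) 0# ≡ t₀ → Id.integralFrom (a n) (b n) τ ≡ t →
        One.integralFrom (a n) (b n) τ ≡ s →
        boxMean k n ≡ k * (d n - c n) * (t₀ - t) + k * ((d n - c n) * (τ + ½ * (d n + c n))) * s
      boxMean≡ refl refl refl = cong₂
        (λ w w′ → k * w * (Id.integralFrom (a n) (b n) 0# - Id.integralFrom (a n) (b n) τ) +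
          k * w′ * One.integralFrom (a n) (b n) τ)
        (width≡ n) (weight≡ n)

      whole : Id.integralFrom (a n) (b n) 0# ≡ Id.antiderivative (b n) - Id.antiderivative (a n)
      whole = Id.integralFrom-≤ (0≤a n) (a<b n)

    -- Apart from the edge `x = τ`, which has no area, the first algorithm is always abandoned: the
    -- mass of the box is multiplied by `τ` plus the centre of `[c n , d n)`.
    boxMean-above : τ ≤ a n →
      boxMean k n ≡ k * ((b n - a n) * (d n - c n)) * (τ + ½ * (d n + c n))
    boxMean-above τ≤a = trans
      (boxMean≡ whole (Id.integralFrom-≤ τ≤a (a<b n)) (One.integralFrom-≤ τ≤a (a<b n)))
      (solve 7 (λ k h τ a b c d →
        let W = (:0 :* b :+ h :* :1 :* (b :* b)) :- (:0 :* a :+ h :* :1 :* (a :* a)) in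
        k :* (d :- c) :* (W :- W) :+ k :* ((d :- c) :* (τ :+ h :* (d :+ c))) :*
          ((:1 :* b :+ h :* :0 :* (b :* b)) :- (:1 :* a :+ h :* :0 :* (a :* a))) :=
        k :* ((b :- a) :* (d :- c)) :* (τ :+ h :* (d :+ c)))
        refl k ½ τ (a n) (b n) (c n) (d n))

    -- The first algorithm always finishes, so the mass of the box is multiplied by the centre of
    -- `[a n , b n)`.
    boxMean-below : b n ≤ τ →
      boxMean k n ≡ k * ((b n - a n) * (d n - c n)) * (½ * (b n + a n))
    boxMean-below b≤τ = trans
      (boxMean≡ whole (Id.integralFrom-≥ (a<b n) b≤τ) (One.integralFrom-≥ (a<b n) b≤τ))
      (solve 7 (λ k h τ a b c d →
        k :* (d :- c) :* (((:0 :* b :+ h :* :1 :* (b :* b)) :- (:0 :* a :+ h :* :1 :* (a :* a))) :- :0) :+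
          k :* ((d :- c) :* (τ :+ h :* (d :+ c))) :* :0 :=
        k :* ((b :- a) :* (d :- c)) :* (h :* (b :+ a)))
        refl k ½ τ (a n) (b n) (c n) (d n))

    -- The limit cuts the box: `½ * (τ * τ - a n * a n)` is the integral of `x` up to `τ`, and the
    -- remaining width `b n - τ` is charged `τ` plus the centre of `[c n , d n)`.
    boxMean-inside : a n ≤ τ → τ ≤ b n →
      boxMean k n ≡ k * (d n - c n) *
        (½ * (τ * τ - a n * a n) + (b n - τ) * (τ + ½ * (d n + c n)))
    boxMean-inside a≤τ τ≤b = trans
      (boxMean≡ whole (Id.integralFrom-inside a≤τ τ≤b) (One.integralFrom-inside a≤τ τ≤b))
      (solve 7 (λ k h τ a b c d →
        k :* (d :- c) :*
          (((:0 :* b :+ h :* :1 :* (b :* b)) :- (:0 :* a :+ h :* :1 :* (a :* a))) :-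
           ((:0 :* b :+ h :* :1 :* (b :* b)) :- (:0 :* τ :+ h :* :1 :* (τ :* τ)))) :+
          k :* ((d :- c) :* (τ :+ h :* (d :+ c))) :*
          ((:1 :* b :+ h :* :0 :* (b :* b)) :- (:1 :* τ :+ h :* :0 :* (τ :* τ))) :=
        k :* (d :- c) :* (h :* (τ :* τ :- a :* a) :+ (b :- τ) :* (τ :+ h :* (d :+ c))))
        refl k ½ τ (a n) (b n) (c n) (d n))

  -- Comparison of the sum over boxes with the closed formula.

  module _ {P : ℕ} .{{_ : NonZero P}} (xs : Fin P → ℝ × ℝ) where

    open Likelihood xs

    private
      P# 2P : ℝ
      P# = fromℕ P
      2P = fromℕ 2 * P#

      0<P : 0# < P#
      0<P = 0<fromℕ P

      -- Brings the constants of the formula and of the integrals to the same atoms `½` and `P# ⁻¹`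
      -- for the solver.
      2P⁻¹≡ : 2P ⁻¹ ≡ ½ * P# ⁻¹
      2P⁻¹≡ = ⁻¹-unique (*-positive (0<fromℕ 2) 0<P) (trans
        (solve 3 (λ p h q → :2 :* p :* (h :* q) := (h :+ h) :* (p :* q)) refl P# ½ (P# ⁻¹))
        (trans (cong₂ _*_ ½+½≡1 (*-inverse 0<P)) (*-identityˡ 1#)))

    module _ (n : Fin N) where

      private
        s w h : ℝ
        s = fromℕ (S n)
        w = b n - a n
        h = d n - c n

        0<w : 0# < w
        0<w = x<y⇒0<y-x (a<b n)

        0<h : 0# < h
        0<h = x<y⇒0<y-x (c<d n)

        fitted-*h : fitted n * h ≡ s * P# ⁻¹ * w ⁻¹
        fitted-*h = *-cancelˡ (*-positive 0<P 0<w) (trans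
          (solve 4 (λ p w k h → p :* w :* (k :* h) := k :* (p :* w :* h)) refl P# w (fitted n) h)
          (trans (/-*-cancel s (*-positive (*-positive 0<P 0<w) 0<h)) (sym (trans
            (solve 5 (λ p w s p′ w′ → p :* w :* (s :* p′ :* w′) := s :* ((p :* p′) :* (w :* w′)))
              refl P# w s (P# ⁻¹) (w ⁻¹))
            (trans (cong₂ (λ x y → s * (x * y)) (*-inverse 0<P) (*-inverse 0<w))
              (trans (cong (s *_) (*-identityˡ 1#)) (*-identityʳ s)))))))

        fitted-*wh : fitted n * (w * h) ≡ s * P# ⁻¹
        fitted-*wh = begin
          fitted n * (w * h)            ≡⟨ solve 3 (λ k w h → k :* (w :* h) := k :* h :* w) refl (fitted n) w h ⟩
          fitted n * h * w              ≡⟨ cong (_* w) fitted-*h ⟩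
          s / P# / w * w                ≡⟨ /-*-cancel (s / P#) 0<w ⟩
          s * P# ⁻¹                     ∎
          where open ≡-Reasoning

        x₁ x₃ x₄ x₅ x₆ : ℝ
        x₁ = s / w
        x₃ = s * ((b n - ½ * (d n + c n)) / w)
        x₄ = s / w * (b n * (d n + c n) - a n ^ 2)
        x₅ = s * (d n + c n)
        x₆ = s * (b n + a n)

      above : τ ≤ a n →
        combination (τ ^ 2 / 2P) (τ / P#) (1# / 2P) 0# s 0# 0# x₅ 0# ≡ boxMean (fitted n) n
      above τ≤a = begin
        combination (τ ^ 2 / 2P) (τ / P#) (1# / 2P) 0# s 0# 0# x₅ 0#
          ≡⟨ cong (λ i → combination (τ ^ 2 * i) (τ / P#) (1# * i) 0# s 0# 0# x₅ 0#) 2P⁻¹≡ ⟩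
        combination (τ ^ 2 * (½ * P# ⁻¹)) (τ / P#) (1# * (½ * P# ⁻¹)) 0# s 0# 0# x₅ 0#
          ≡⟨ solve 5 (λ τ h q s e →
               :- (τ :* (τ :* :1) :* (h :* q) :* :0) :+ τ :* q :* (s :+ :0) :+ :1 :* (h :* q) :* :0 :+
                 :1 :* (h :* q) :* (s :* e) :+ :1 :* (h :* q) :* :0 :=
               s :* q :* (τ :+ h :* e))
               refl τ ½ (P# ⁻¹) s (d n + c n) ⟩
        s * P# ⁻¹ * (τ + ½ * (d n + c n))
          ≡⟨ cong (_* (τ + ½ * (d n + c n))) fitted-*wh ⟨
        fitted n * (w * h) * (τ + ½ * (d n + c n))
          ≡⟨ boxMean-above (fitted n) n τ≤a ⟨
        boxMean (fitted n) n ∎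
        where open ≡-Reasoning

      below : b n ≤ τ →
        combination (τ ^ 2 / 2P) (τ / P#) (1# / 2P) 0# 0# 0# 0# 0# x₆ ≡ boxMean (fitted n) n
      below b≤τ = begin
        combination (τ ^ 2 / 2P) (τ / P#) (1# / 2P) 0# 0# 0# 0# 0# x₆
          ≡⟨ cong (λ i → combination (τ ^ 2 * i) (τ / P#) (1# * i) 0# 0# 0# 0# 0# x₆) 2P⁻¹≡ ⟩
        combination (τ ^ 2 * (½ * P# ⁻¹)) (τ / P#) (1# * (½ * P# ⁻¹)) 0# 0# 0# 0# 0# x₆
          ≡⟨ solve 5 (λ τ h q s e →
               :- (τ :* (τ :* :1) :* (h :* q) :* :0) :+ τ :* q :* (:0 :+ :0) :+ :1 :* (h :* q) :* :0 :+
                 :1 :* (h :* q) :* :0 :+ :1 :* (h :* q) :* (s :* e) :=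
               s :* q :* (h :* e))
               refl τ ½ (P# ⁻¹) s (b n + a n) ⟩
        s * P# ⁻¹ * (½ * (b n + a n))
          ≡⟨ cong (_* (½ * (b n + a n))) fitted-*wh ⟨
        fitted n * (w * h) * (½ * (b n + a n))
          ≡⟨ boxMean-below (fitted n) n b≤τ ⟨
        boxMean (fitted n) n ∎
        where open ≡-Reasoning

      inside : a n ≤ τ → τ ≤ b n →
        combination (τ ^ 2 / 2P) (τ / P#) (1# / 2P) x₁ 0# x₃ x₄ 0# 0# ≡ boxMean (fitted n) n
      inside a≤τ τ≤b = begin
        combination (τ ^ 2 / 2P) (τ / P#) (1# / 2P) x₁ 0# x₃ x₄ 0# 0#
          ≡⟨ cong (λ i → combination (τ ^ 2 * i) (τ / P#) (1# * i) x₁ 0# x₃ x₄ 0# 0#) 2P⁻¹≡ ⟩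
        combination (τ ^ 2 * (½ * P# ⁻¹)) (τ / P#) (1# * (½ * P# ⁻¹)) x₁ 0# x₃ x₄ 0# 0#
          -- With `½` an atom the two sides are not equal as polynomials: the coefficient of `τ * τ`
          -- is `- ½` on the left and `½ - 1` on the right. The summand with the factor
          -- `1# - (½ + ½)` makes up the difference and is then removed.
          ≡⟨ solve 8 (λ τ h q s w′ a b e →
               :- (τ :* (τ :* :1) :* (h :* q) :* (s :* w′)) :+ τ :* q :* (:0 :+ s :* ((b :- h :* e) :* w′)) :+
                 :1 :* (h :* q) :* (s :* w′ :* (b :* e :- a :* (a :* :1))) :+
                 :1 :* (h :* q) :* :0 :+ :1 :* (h :* q) :* :0 :=
               s :* q :* w′ :* (h :* (τ :* τ :- a :* a) :+ (b :- τ) :* (τ :+ h :* e)) :+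
                 (:1 :- (h :+ h)) :* (s :* q :* w′ :* (τ :* τ)))
               refl τ ½ (P# ⁻¹) s (w ⁻¹) (a n) (b n) (d n + c n) ⟩
        s * P# ⁻¹ * w ⁻¹ * E + (1# - (½ + ½)) * (s * P# ⁻¹ * w ⁻¹ * (τ * τ))
          ≡⟨ cong₂ (λ z k → k * E + z * (s * P# ⁻¹ * w ⁻¹ * (τ * τ)))
               (trans (cong (λ e → 1# - e) ½+½≡1) (-‿inverseʳ 1#)) (sym fitted-*h) ⟩
        fitted n * h * E + 0# * (s * P# ⁻¹ * w ⁻¹ * (τ * τ))
          ≡⟨ trans (cong (fitted n * h * E +_) (zeroˡ _)) (+-identityʳ _) ⟩
        fitted n * h * E
          ≡⟨ boxMean-inside (fitted n) n a≤τ τ≤b ⟨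
        boxMean (fitted n) n ∎
        where
        open ≡-Reasoning
        E : ℝ
        E = ½ * (τ * τ - a n * a n) + (b n - τ) * (τ + ½ * (d n + c n))

      -- Arbitrary decisions as arguments let matching on them reduce the conditionals. Since
      -- `a n < b n`, exactly one of the three tests succeeds; the ties `τ ≡ a n` and `τ ≡ b n` fall
      -- under `above` and `below`.
      term≡boxMean : (inside? : Dec ((a n < τ) × (τ < b n)))
        (above? : Dec (τ ≤ a n)) (below? : Dec (b n ≤ τ)) →
        combination (τ ^ 2 / 2P) (τ / P#) (1# / 2P)
          (if does inside? then x₁ else 0#) (if does above? then s else 0#)
          (if does inside? then x₃ else 0#) (if does inside? then x₄ else 0#)
          (if does above? then x₅ else 0#) (if does below? then x₆ else 0#)
        ≡ boxMean (fitted n) n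
      term≡boxMean (yes (a<τ , _)) (yes τ≤a) _         = contradiction τ≤a (<⇒≱ a<τ)
      term≡boxMean (yes (_ , τ<b)) _         (yes b≤τ) = contradiction b≤τ (<⇒≱ τ<b)
      term≡boxMean (yes (a<τ , τ<b)) (no _)  (no _)    = inside (<⇒≤ a<τ) (<⇒≤ τ<b)
      term≡boxMean (no _)          (yes τ≤a) (yes b≤τ) = contradiction (≤-trans b≤τ τ≤a) (<⇒≱ (a<b n))
      term≡boxMean (no _)          (yes τ≤a) (no _)    = above τ≤a
      term≡boxMean (no _)          (no _)    (yes b≤τ) = below b≤τ
      term≡boxMean (no ¬inside)    (no τ≰a)  (no b≰τ)  = contradiction (≰⇒> τ≰a , ≰⇒> b≰τ) ¬inside

    meanFormula≡∑boxMean : meanFormula τ ≡ ∑ (λ n → boxMean (fitted n) n)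
    meanFormula≡∑boxMean = trans
      (combination-∑ (τ ^ 2 / 2P) (τ / P#) (1# / 2P) {N} _ _ _ _ _ _)
      (∑.sum-cong-≗ λ n → term≡boxMean n ((a n <? τ) ×-dec (τ <? b n)) (τ ≤? a n) (b n ≤? τ))

mainTheorem3 :
  (𝓡 : CompleteOrderedField) → let open Fitting 𝓡 in
  {Task Output : Set} (α₁ α₂ : Algorithm Task Output) → Equivalent α₁ α₂ →
  (P N : ℕ) .{{_ : NonZero P}} →
  (ω : Fin P → Task) → Injective _≡_ _≡_ ω →
  (B : Fin N → Box) → PairwiseDisjoint B →
  let sample : Fin P → ℝ × ℝ
      sample m = time α₁ (ω m) , time α₂ (ω m)
      open Model B
      open Likelihood sample
  in
  (∀ m → ∃[ n ] InBox (B n) (sample m)) →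
    (∀ k → likelihood k ≡ ∏ (λ n → k n ^ S n))
  × (∀ k → Maximizes Admissible k → ∀ n → k n ≡ fitted n)
  × ((∀ n → 0 ℕ.< S n) → Maximizes Admissible fitted)
  × Maximizes Admissible₀ fitted
  × (∀ k → Maximizes Admissible₀ k → ∀ n → k n ≡ fitted n)
  × (∀ τ → 0# ≤ τ → DerivedTimeHasMean (density fitted) τ (meanFormula τ))
mainTheorem3 𝓡 α₁ α₂ _ P N ω _ B disjoint covered =
  likelihood≡ , maximizer≡fitted , fitted-maximizes , fitted-maximizes₀ , maximizer₀≡fitted ,
  λ τ 0≤τ → let open DerivedMean 𝓡 B τ 0≤τ in
    subst (DerivedTimeHasMean (density fitted) τ) (sym (meanFormula≡∑boxMean sample))
      (derivedTimeHasMean fitted 0≤fitted)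
  where
  open Fitting 𝓡
  sample : Fin P → ℝ × ℝ
  sample m = time α₁ (ω m) , time α₂ (ω m)
  open Model B
  open Likelihood sample
  open MaximumLikelihood 𝓡 B disjoint sample covered
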